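{- Let $G=(V,E)$ be an oriented 3-edge-connected graph with $\ell=|E|-|V|$ and let $\Gamma$ be an abelian group with $|\Gamma|=k\ge 6$ ($k$ finite). For every function $f:E\to\Gamma$, the number of flows $\phi:E\to\Gamma$ satisfying $\phi(e)\neq f(e)$ for every $e\in E$ is at least $$\frac12\left(\frac{k-6}{2}\right)^{\ell}\ \text{ if } k \text{ is odd},\qquad \frac12\left(\frac{k-4}{2}\right)^{\ell}\ \text{ if } k \text{ is even}.$$
   Context: Graphs are finite and may have loops and parallel edges. A graph is $k$-edge-connected if it has at least two vertices and remains connected after deleting any set of fewer than $k$ edges (for oriented graphs this refers to the underlying undirected graph). For an oriented graph $G=(V,E)$ and $v\in V$, $\delta^+(v)$ is the set of edges with initial vertex $v$ and $\delta^-(v)$ the set of edges with terminal vertex $v$ (a loop at $v$ belongs to both). For an additive abelian group $\Gamma$, a flow is a function $\phi:E\to\Gamma$ with $\sum_{e\in\delta^+(v)}\phi(e)=\sum_{e\in\delta^-(v)}\phi(e)$ for every $v\in V$. -}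

module Defs where

open import Level using (Level; _⊔_)
open import Algebra.Bundles using (AbelianGroup)
import Algebra.Definitions.RawMonoid as RawMonoidDefs
import Algebra.Definitions.RawSemiring as RawSemiringDefs
open import Data.Bool.Base using (if_then_else_)
open import Data.Fin.Base using (Fin)
open import Data.Fin.Properties using (_≟_)
open import Data.Fin.Subset using (Subset; _∉_; ∣_∣)
open import Data.Nat.Base using (ℕ; _≤_; _<_)
open import Data.Product.Base using (Σ; _×_; ∃-syntax; proj₁)
open import Data.Rational.Base using (ℚ; +-*-rawSemiring)
import Data.Vec.Functional.Relation.Binary.Equality.Setoid as VectorEquality
open import Function.Bundles using (Inverse)
open import Relation.Binary.Bundles using (Setoid)
open import Relation.Binary.Construct.Closure.Equivalence using (EqClosure)
import Relation.Binary.Construct.On as On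
open import Relation.Binary.PropositionalEquality using (_≡_; setoid)
open import Relation.Nullary.Decidable using (⌊_⌋)
open import Relation.Nullary.Negation using (¬_)

private
  variable
    a c r : Level

HasCardinality : Setoid a r → ℕ → Set (a ⊔ r)
HasCardinality S n = Inverse S (setoid (Fin n))

infixr 8 _^_
_^_ : ℚ → ℕ → ℚ
_^_ = RawSemiringDefs._^_ +-*-rawSemiring

record OrientedGraph : Set where
  field
    #V     : ℕ
    #E     : ℕ
    source : Fin #E → Fin #V
    target : Fin #E → Fin #V

  Vertex : Set
  Vertex = Fin #V

  Edge : Set
  Edge = Fin #E

  -- u → v is an arc of the graph remaining after the edges in S are deleted.
  ArcAvoiding : Subset #E → Vertex → Vertex → Set
  ArcAvoiding S u v = ∃[ e ] (e ∉ S × source e ≡ u × target e ≡ v)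

  -- Connectivity ignores orientation: EqClosure relates u and v exactly when
  -- some walk, traversing arcs in either direction, joins them.
  ConnectedAfterDeleting : Subset #E → Set
  ConnectedAfterDeleting S = ∀ u v → EqClosure (ArcAvoiding S) u v

  EdgeConnected : ℕ → Set
  EdgeConnected k =
    2 ≤ #V × (∀ (S : Subset #E) → ∣ S ∣ < k → ConnectedAfterDeleting S)

module Flows (G : OrientedGraph) (Γ : AbelianGroup c r) where
  open OrientedGraph G
  open AbelianGroup Γ using (Carrier; _≈_; ε; rawMonoid) renaming (setoid to Γ-setoid)
  open RawMonoidDefs rawMonoid using (sum)

  outflow : (Edge → Carrier) → Vertex → Carrier
  outflow φ v = sum (λ e → if ⌊ source e ≟ v ⌋ then φ e else ε)

  inflow : (Edge → Carrier) → Vertex → Carrier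
  inflow φ v = sum (λ e → if ⌊ target e ≟ v ⌋ then φ e else ε)

  IsFlow : (Edge → Carrier) → Set r
  IsFlow φ = ∀ v → outflow φ v ≈ inflow φ v

  FlowAvoiding : (Edge → Carrier) → Set (c ⊔ r)
  FlowAvoiding f = Σ (Edge → Carrier) λ φ → IsFlow φ × (∀ e → ¬ (φ e ≈ f e))

  -- Flows are identified when they agree on every edge; the proofs of the flow
  -- and avoidance conditions play no role in the equality.
  flowsAvoiding : (Edge → Carrier) → Setoid (c ⊔ r) r
  flowsAvoiding f =
    On.setoid {B = FlowAvoiding f} (VectorEquality.≋-setoid Γ-setoid #E) proj₁

{-# OPTIONS --safe #-}
-- Fix a ≠ 0 in Γ, of order two if k is even, so that the set A = {0, a, -a} has size 2 or 3.
--
-- Say that an edge set C is good if G - C is connected and all edges of G can be reached from C by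
-- repeatedly adding one or two edges that lie on a closed walk through the edges already present.
-- For a good C run through these additions backwards: adding x ∈ Γ along the closed walk changes each
-- of the at most two new edges by ± x, so all but 2|A| values of x make both of them avoid f - A.
-- This yields many flows φ with φ(e) + A ∌ f(e) outside C. As G - C is connected there is a ℤ₂-flow
-- whose restriction to C is the set where φ = f, and an Eulerian orientation of its support turns it
-- into a flow ψ with values in A. Then φ + ψ avoids f on all edges, and φ is recovered from φ + ψ
-- and the restriction of ψ to C, so at most 2^|C| flows φ give the same φ + ψ.
--
-- A good C exists for 3-edge-connected G. Grow a vertex set X spanned by edges already reached. In a
-- component Q of G - X there are a connected spanning edge set J and two edges t₁, t₂ from Q to X
-- whose ends in Q are joined by edges of Q outside J: adding those edges to C keeps G - C connected,
-- and t₁, t₂ then lie on a common closed walk. Such a J is found by enlarging it as long as it misses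
-- a component W of the rest of Q: at least three edges leave W, and one of them can be given to J.

module Submission where

open import Defs
open import Level using (Level)
open import Algebra.Bundles using (AbelianGroup)
open import Data.Integer.Base as ℤ using (+_)
open import Data.Nat.Base using (ℕ; _∸_) renaming (_≥_ to _≥ℕ_)
open import Data.Nat.Divisibility using (_∣_; _∤_)
open import Data.Product.Base using (_×_; ∃-syntax)
open import Data.Rational.Base using (ℚ; ½; _/_; _*_; _≥_)

open import Level using (_⊔_; 0ℓ)
open import Algebra.Bundles using (CommutativeMonoid)
import Algebra.Properties.AbelianGroup as AbelianGroupProperties
import Algebra.Properties.CommutativeMonoid.Sum as Summation
import Algebra.Properties.CommutativeSemigroup as CommutativeSemigroupProperties
open import Data.Bool.Base using (Bool; true; false; not; _∧_; _∨_; _xor_; if_then_else_)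
import Data.Bool.Properties as Bool
open import Data.Bool.Properties using (∧-conicalˡ; ∧-conicalʳ; ∨-conicalˡ)
open import Data.Fin.Base using (Fin; zero; suc; finToFun; funToFin; combine; remQuot; inject≤; splitAt; _↑ˡ_; _↑ʳ_)
open import Data.Fin.Properties using (_≟_; any?; all?; suc-injective; finToFun-funToFin; funToFin-finToFin; combine-injective; combine-remQuot; injective⇒≤; inject≤-injective; splitAt-↑ˡ; splitAt-↑ʳ)
open import Data.Fin.Subset using (_∉_; ∣_∣)
import Data.Integer.Properties as ℤ
open import Data.Nat.Base using (zero; suc; _+_; _≤_; _<_; z≤n; s≤s; NonZero; >-nonZero) renaming (_*_ to _*ℕ_; _^_ to _^ℕ_)
open import Data.Nat.Divisibility using (divides; _∣?_; ∣m+n∣m⇒∣n; ∣1⇒≡1; ∣m∣n⇒∣m+n; ∣-refl)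
import Data.Nat.Properties as ℕ
open import Data.Nat.Properties using (≤-refl; ≤-trans; ≤-reflexive; ≤-antisym; ≤-<-trans; ≤-pred; ≰⇒>; _≤?_; +-mono-≤; +-monoʳ-≤; +-monoˡ-≤; +-suc; +-comm; m≤n+o⇒m∸n≤o; *-identityˡ; *-assoc; *-comm; *-monoʳ-≤; module ≤-Reasoning)
open import Data.Nat.Solver using (module +-*-Solver)
open import Data.Parity.Base using (Parity; 0ℙ; 1ℙ) renaming (_+_ to _+ℙ_)
open import Data.Parity.Properties using (+-0-abelianGroup; +-identityʳ)
open import Data.Product.Base using (Σ; _,_; proj₁; proj₂)
open import Data.Rational.Base using (toℚᵘ; Positive) renaming (_≤_ to _≤ℚ_)
import Data.Rational.Properties as ℚ
open import Data.Rational.Unnormalised.Base as ℚᵘ using (mkℚᵘ; *≡*; *≤*)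
import Data.Rational.Unnormalised.Properties as ℚᵘ
open import Data.Sum.Base using (_⊎_; inj₁; inj₂; [_,_]′; swap)
open import Data.Unit.Base using (⊤; tt)
open import Data.Vec.Base using (tabulate)
open import Data.Vec.Functional using (updateAt)
open import Data.Vec.Functional.Properties using (updateAt-updates; updateAt-minimal)
import Data.Vec.Functional.Relation.Binary.Equality.Setoid as VectorEquality
open import Data.Vec.Properties using (lookup∘tabulate; lookup⇒[]=)
open import Function.Base using (_∘_; const)
open import Function.Bundles using (Inverse)
open import Function.Definitions using (Injective)
open import Relation.Binary.Construct.Closure.Equivalence using (EqClosure)
open import Relation.Binary.Construct.Closure.ReflexiveTransitive using (_◅_) renaming (ε to εˢ)
open import Relation.Binary.Construct.Closure.Symmetric using (fwd; bwd)
import Relation.Binary.Construct.On as On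
open import Relation.Binary.PropositionalEquality as ≡ using (_≡_; _≢_)
import Relation.Binary.Reasoning.Setoid as SetoidReasoning
open import Relation.Nullary.Decidable using (Dec; does; yes; no; dec-true; dec-false; ⌊_⌋; map′; ¬?; _×-dec_; _→-dec_)
open import Relation.Nullary.Negation using (¬_; contradiction)

open CommutativeSemigroupProperties ℕ.+-commutativeSemigroup using () renaming (interchange to +-interchange)
open CommutativeSemigroupProperties ℕ.*-commutativeSemigroup using () renaming (x∙yz≈y∙xz to *-swap)
open CommutativeSemigroupProperties (CommutativeMonoid.commutativeSemigroup ℚ.*-1-commutativeMonoid)
  using () renaming (interchange to ℚ-interchange)

private
  variable
    c ρ p q : Level
    m n : ℕ

-- Boolean subsets of `Fin n` and their cardinalities

BoolSubset : ℕ → Set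
BoolSubset n = Fin n → Bool

bit : Bool → ℕ
bit true  = 1
bit false = 0

count : BoolSubset n → ℕ
count {zero}  P = 0
count {suc n} P = bit (P zero) + count (P ∘ suc)

true≢false : ∀ {b} → b ≡ true → b ≢ false
true≢false ≡.refl ()

∧-intro : ∀ {a b} → a ≡ true → b ≡ true → a ∧ b ≡ true
∧-intro ≡.refl ≡.refl = ≡.refl

∨-introˡ : ∀ {a b} → a ≡ true → a ∨ b ≡ true
∨-introˡ ≡.refl = ≡.refl

∨-introʳ : ∀ a {b} → b ≡ true → a ∨ b ≡ true
∨-introʳ true  _ = ≡.refl
∨-introʳ false p = p

∨-elim : ∀ a {b} → a ∨ b ≡ true → a ≡ true ⊎ b ≡ true
∨-elim true  _ = inj₁ ≡.refl
∨-elim false p = inj₂ p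

not-true : ∀ {a} → a ≡ false → not a ≡ true
not-true ≡.refl = ≡.refl

not-elim : ∀ {a} → not a ≡ true → a ≡ false
not-elim {false} _ = ≡.refl

not-false : ∀ {a} → not a ≡ false → a ≡ true
not-false {true} _ = ≡.refl

bool-cases : ∀ b → b ≡ true ⊎ b ≡ false
bool-cases true  = inj₁ ≡.refl
bool-cases false = inj₂ ≡.refl

search : (P : BoolSubset n) → (∃[ i ] P i ≡ true) ⊎ (∀ i → P i ≡ false)
search {zero}  P = inj₂ λ ()
search {suc n} P with bool-cases (P zero) | search (P ∘ suc)
... | inj₁ p | _            = inj₁ (zero , p)
... | inj₂ _ | inj₁ (i , p) = inj₁ (suc i , p)
... | inj₂ p | inj₂ q       = inj₂ λ { zero → p ; (suc i) → q i }

_==_ : Fin n → Fin n → Bool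
i == j = does (i ≟ j)

does-true : {A : Set p} (d : Dec A) → does d ≡ true → A
does-true (yes a) _ = a

does-false : {A : Set p} (d : Dec A) → does d ≡ false → ¬ A
does-false (no ¬a) _ = ¬a

==-refl : (i : Fin n) → (i == i) ≡ true
==-refl i = dec-true (i ≟ i) ≡.refl

==⇒≡ : {i j : Fin n} → (i == j) ≡ true → i ≡ j
==⇒≡ = does-true (_ ≟ _)

≢⇒==-false : {i j : Fin n} → i ≢ j → (i == j) ≡ false
≢⇒==-false = dec-false (_ ≟ _)

bit-mono : ∀ {a b} → (a ≡ true → b ≡ true) → bit a ≤ bit b
bit-mono {false}        _ = z≤n
bit-mono {true} {true}  _ = ≤-refl
bit-mono {true} {false} h with () ← h ≡.refl

count-mono : {P Q : BoolSubset n} → (∀ i → P i ≡ true → Q i ≡ true) → count P ≤ count Q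
count-mono {zero}  h = z≤n
count-mono {suc n} h = +-mono-≤ (bit-mono (h zero)) (count-mono (h ∘ suc))

count-mono-< : {P Q : BoolSubset n} → (∀ i → P i ≡ true → Q i ≡ true) →
               ∀ i → P i ≡ false → Q i ≡ true → count P < count Q
count-mono-< h zero    p q rewrite p | q = s≤s (count-mono (h ∘ suc))
count-mono-< {P = P} h (suc i) p q =
  ≤-trans (≤-reflexive (≡.sym (+-suc (bit (P zero)) _)))
          (+-mono-≤ (bit-mono (h zero)) (count-mono-< (h ∘ suc) i p q))

count-∪ : {P Q R : BoolSubset n} → (∀ i → R i ≡ true → P i ≡ true ⊎ Q i ≡ true) →
          count R ≤ count P + count Q
count-∪ {zero}                  h = z≤n
count-∪ {suc n} {P} {Q} {R} h =
  ≤-trans (+-mono-≤ (head (P zero) (Q zero) (R zero) (h zero)) (count-∪ (h ∘ suc)))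
          (≤-reflexive (+-interchange (bit (P zero)) (bit (Q zero)) _ _))
  where
  head : ∀ p q r → (r ≡ true → p ≡ true ⊎ q ≡ true) → bit r ≤ bit p + bit q
  head p     q     false _ = z≤n
  head true  q     true  _ = s≤s z≤n
  head false true  true  _ = ≤-refl
  head false false true  h with h ≡.refl
  ... | inj₁ ()
  ... | inj₂ ()

count-disjoint : {P Q R : BoolSubset n} → (∀ i → P i ≡ true → R i ≡ true) →
                 (∀ i → Q i ≡ true → R i ≡ true) → (∀ i → P i ≡ true → Q i ≡ false) →
                 count P + count Q ≤ count R
count-disjoint {zero}              _ _ _ = z≤n
count-disjoint {suc n} {P} {Q} {R} f g d =
  ≤-trans (≤-reflexive (+-interchange (bit (P zero)) _ (bit (Q zero)) _))
          (+-mono-≤ (head (P zero) (Q zero) (R zero) (f zero) (g zero) (d zero))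
                    (count-disjoint (f ∘ suc) (g ∘ suc) (d ∘ suc)))
  where
  head : ∀ p q r → (p ≡ true → r ≡ true) → (q ≡ true → r ≡ true) →
         (p ≡ true → q ≡ false) → bit p + bit q ≤ bit r
  head true  q     r f g d rewrite f ≡.refl | d ≡.refl = ≤-refl
  head false true  r f g d rewrite g ≡.refl = ≤-refl
  head false false r f g d = z≤n

count-full : (P : BoolSubset n) → (∀ i → P i ≡ true) → count P ≡ n
count-full {zero}  P h = ≡.refl
count-full {suc n} P h rewrite h zero = ≡.cong suc (count-full (P ∘ suc) (h ∘ suc))

count≤ : (P : BoolSubset n) → count P ≤ n
count≤ P = ≤-trans (count-mono {P = P} {Q = λ _ → true} (λ _ _ → ≡.refl))
                   (≤-reflexive (count-full (λ _ → true) λ _ → ≡.refl))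

remove : Fin n → BoolSubset n → BoolSubset n
remove i P j = P j ∧ not (i == j)

remove-other : {P : BoolSubset n} {i j : Fin n} → P j ≡ true → i ≢ j → remove i P j ≡ true
remove-other p i≢j = ∧-intro p (not-true (≢⇒==-false i≢j))

remove-self : (P : BoolSubset n) (i : Fin n) → remove i P i ≡ false
remove-self P i with P i
... | true  rewrite ==-refl i = ≡.refl
... | false = ≡.refl

remove-⊆ : (P : BoolSubset n) (i j : Fin n) → remove i P j ≡ true → P j ≡ true × i ≢ j
remove-⊆ P i j p =
  ∧-conicalˡ (P j) _ p ,
  λ { ≡.refl → true≢false p (remove-self P i) }

count-none : (P : BoolSubset n) → (∀ i → P i ≡ false) → count P ≡ 0
count-none {zero}  P h = ≡.refl
count-none {suc n} P h rewrite h zero = count-none (P ∘ suc) (h ∘ suc)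

count-singleton : (i : Fin n) → count (i ==_) ≡ 1
count-singleton {suc n} zero    = ≡.cong suc (count-none {n} (λ _ → false) λ _ → ≡.refl)
count-singleton {suc n} (suc i) = count-singleton i

count-remove : (P : BoolSubset n) (i : Fin n) → P i ≡ true → count P ≡ suc (count (remove i P))
count-remove P i p = ≤-antisym
  (≤-trans (count-∪ {P = i ==_} {Q = remove i P} split)
           (≤-reflexive (≡.cong (_+ count (remove i P)) (count-singleton i))))
  (count-mono-< (λ j → proj₁ ∘ remove-⊆ P i j) i (remove-self P i) p)
  where
  split : ∀ j → P j ≡ true → (i == j) ≡ true ⊎ remove i P j ≡ true
  split j q with i ≟ j
  ... | yes _ = inj₁ ≡.refl
  ... | no  _ = inj₂ (∧-intro q ≡.refl)

enumerate : (P : BoolSubset n) → Fin (count P) → Fin n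
enumerate {suc n} P i with P zero
... | false = suc (enumerate (P ∘ suc) i)
enumerate {suc n} P zero    | true = zero
enumerate {suc n} P (suc i) | true = suc (enumerate (P ∘ suc) i)

enumerate-∈ : (P : BoolSubset n) (i : Fin (count P)) → P (enumerate P i) ≡ true
enumerate-∈ {suc n} P i with P zero in eq
... | false = enumerate-∈ (P ∘ suc) i
enumerate-∈ {suc n} P zero    | true = eq
enumerate-∈ {suc n} P (suc i) | true = enumerate-∈ (P ∘ suc) i

enumerate-injective : (P : BoolSubset n) → Injective _≡_ _≡_ (enumerate P)
enumerate-injective {suc n} P {i} {j} eq with P zero
... | false = enumerate-injective (P ∘ suc) (suc-injective eq)
enumerate-injective {suc n} P {zero}  {zero}  eq | true = ≡.refl
enumerate-injective {suc n} P {suc i} {suc j} eq | true =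
  ≡.cong suc (enumerate-injective (P ∘ suc) (suc-injective eq))

rank : (P : BoolSubset n) (j : Fin n) → P j ≡ true → ∃[ i ] enumerate P i ≡ j
rank {suc n} P zero p with P zero
... | true = zero , ≡.refl
rank {suc n} P (suc j) p with P zero | rank (P ∘ suc) j p
... | true  | i , eq = suc i , ≡.cong suc eq
... | false | i , eq = i , ≡.cong suc eq

choose-three : (P : BoolSubset n) → 3 ≤ count P →
               ∃[ i ] ∃[ j ] ∃[ k ] (P i ≡ true × P j ≡ true × P k ≡ true × i ≢ j × i ≢ k × j ≢ k)
choose-three P 3≤ =
  at zero , at (suc zero) , at (suc (suc zero)) ,
  enumerate-∈ P _ , enumerate-∈ P _ , enumerate-∈ P _ ,
  distinct (λ ()) , distinct (λ ()) , distinct (λ ())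
  where
  at : Fin 3 → Fin _
  at i = enumerate P (inject≤ i 3≤)
  distinct : ∀ {i j} → i ≢ j → at i ≢ at j
  distinct i≢j eq = i≢j (inject≤-injective 3≤ 3≤ _ _ (enumerate-injective P eq))

∣tabulate∣≡count : ∀ {n} (P : BoolSubset n) → ∣ tabulate P ∣ ≡ count P
∣tabulate∣≡count {zero}  P = ≡.refl
∣tabulate∣≡count {suc n} P with P zero
... | true  = ≡.cong suc (∣tabulate∣≡count (P ∘ suc))
... | false = ∣tabulate∣≡count (P ∘ suc)

∉-tabulate : ∀ {n} {P : BoolSubset n} {i} → i ∉ tabulate P → P i ≡ false
∉-tabulate {P = P} {i} i∉ with bool-cases (P i)
... | inj₂ p = p
... | inj₁ p = contradiction (lookup⇒[]= i (tabulate P) (≡.trans (lookup∘tabulate P i) p)) i∉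

-- Walks and connected components

module Walks (G : OrientedGraph) where
  open OrientedGraph G

  VertexSet EdgeSet : Set
  VertexSet = BoolSubset #V
  EdgeSet = BoolSubset #E

  Joins : Edge → Vertex → Vertex → Set
  Joins e u v = (source e ≡ u × target e ≡ v) ⊎ (source e ≡ v × target e ≡ u)

  joins-sym : ∀ {e u v} → Joins e u v → Joins e v u
  joins-sym = swap

  data Walk (A : EdgeSet) : Vertex → Vertex → Set where
    nil  : ∀ {u} → Walk A u u
    step : ∀ {u v w} e → A e ≡ true → Joins e u v → Walk A v w → Walk A u w

  edgeWalk : ∀ {A e u v} → A e ≡ true → Joins e u v → Walk A u v
  edgeWalk e∈A j = step _ e∈A j nil

  infixr 5 _++_
  _++_ : ∀ {A u v w} → Walk A u v → Walk A v w → Walk A u w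
  nil          ++ q = q
  step e a j p ++ q = step e a j (p ++ q)

  reverse : ∀ {A u v} → Walk A u v → Walk A v u
  reverse nil            = nil
  reverse (step e a j p) = reverse p ++ edgeWalk a (joins-sym j)

  -- Substitutes a walk for every edge. Detours around deleted edges are inserted this way.
  walk-bind : ∀ {A B u v} → (∀ e {x y} → A e ≡ true → Joins e x y → Walk B x y) →
              Walk A u v → Walk B u v
  walk-bind h nil            = nil
  walk-bind h (step e a j p) = h e a j ++ walk-bind h p

  walk-mono : ∀ {A B u v} → (∀ e → A e ≡ true → B e ≡ true) → Walk A u v → Walk B u v
  walk-mono h = walk-bind λ e a j → edgeWalk (h e a) j

  inside : VertexSet → EdgeSet
  inside X e = X (source e) ∧ X (target e)

  inside-intro : ∀ {X e u v} → Joins e u v → X u ≡ true → X v ≡ true → inside X e ≡ true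
  inside-intro (inj₁ (≡.refl , ≡.refl)) p q = ∧-intro p q
  inside-intro (inj₂ (≡.refl , ≡.refl)) p q = ∧-intro q p

  inside-ends : ∀ X {e u v} → Joins e u v → inside X e ≡ true → X u ≡ true × X v ≡ true
  inside-ends X {e} (inj₁ (≡.refl , ≡.refl)) p = ∧-conicalˡ _ _ p , ∧-conicalʳ (X (source e)) _ p
  inside-ends X {e} (inj₂ (≡.refl , ≡.refl)) p = ∧-conicalʳ (X (source e)) _ p , ∧-conicalˡ _ _ p

  inside-mono : ∀ {X Y} → (∀ v → X v ≡ true → Y v ≡ true) → ∀ e → inside X e ≡ true → inside Y e ≡ true
  inside-mono {X} h e p = ∧-intro (h _ (∧-conicalˡ _ _ p)) (h _ (∧-conicalʳ (X (source e)) _ p))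

  walk-stays : ∀ {A u v} X → (∀ e → A e ≡ true → inside X e ≡ true) →
               Walk A u v → X u ≡ true → X v ≡ true
  walk-stays X h nil            p = p
  walk-stays X h (step e a j w) p = walk-stays X h w (proj₂ (inside-ends X j (h e a)))

  -- Exclusive or, so that a loop never counts as leaving the set.
  boundary : VertexSet → EdgeSet
  boundary X e = X (source e) xor X (target e)

  record Leaves (X : VertexSet) (e : Edge) : Set where
    constructor leaves
    field
      {inner outer} : Vertex
      joins   : Joins e inner outer
      inner∈  : X inner ≡ true
      outer∉  : X outer ≡ false

  boundary⇒leaves : ∀ X e → boundary X e ≡ true → Leaves X e
  boundary⇒leaves X e b with bool-cases (X (source e)) | bool-cases (X (target e))
  ... | inj₁ p | inj₂ q = leaves (inj₁ (≡.refl , ≡.refl)) p q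
  ... | inj₂ p | inj₁ q = leaves (inj₂ (≡.refl , ≡.refl)) q p
  ... | inj₁ p | inj₁ q rewrite p | q with () ← b
  ... | inj₂ p | inj₂ q rewrite p | q with () ← b

  boundary-false : ∀ X {e u v} → boundary X e ≡ false → Joins e u v → X u ≡ true → X v ≡ true
  boundary-false X b (inj₁ (≡.refl , ≡.refl)) p rewrite p = flip-not b
    where
    flip-not : ∀ {b} → not b ≡ false → b ≡ true
    flip-not {true} _ = ≡.refl
  boundary-false X {e} b (inj₂ (≡.refl , ≡.refl)) p rewrite p with X (source e)
  ... | true = ≡.refl

  walk-leaves : ∀ {A u v} X → Walk A u v → X u ≡ true → X v ≡ false →
                ∃[ e ] (A e ≡ true × Leaves X e)
  walk-leaves X nil p q = contradiction q (true≢false p)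
  walk-leaves X (step {v = v} e a j w) p q with bool-cases (X v)
  ... | inj₁ r = walk-leaves X w r q
  ... | inj₂ r = e , a , leaves j p r

  -- `size` is the inequality |V| ≤ |E| + 1 of a connected graph. Both the bound on the number of
  -- closing steps and the bound on the good edge set rest on it.
  record Component (A : EdgeSet) (r : Vertex) : Set where
    field
      members : VertexSet
      root    : members r ≡ true
      reach   : ∀ u → members u ≡ true → Walk (λ e → A e ∧ inside members e) r u
      closed  : ∀ {e u v} → A e ≡ true → Joins e u v → members u ≡ true → members v ≡ true
      size    : count members ≤ suc (count (λ e → A e ∧ inside members e))

  component-walk : ∀ {A r u v} (K : Component A r) → Walk A u v →
                   Component.members K u ≡ true → Component.members K v ≡ true
  component-walk K nil            p = p
  component-walk K (step e a j w) p = component-walk K w (Component.closed K a j p)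

  insert : Edge → EdgeSet → EdgeSet
  insert e S f = S f ∨ (e == f)

  insert-self : ∀ e S → insert e S e ≡ true
  insert-self e S = ∨-introʳ (S e) (==-refl e)

  insert-∉ : ∀ e S {f} → insert e S f ≡ false → S f ≡ false
  insert-∉ e S = ∨-conicalˡ (S _) _

  insert-count : ∀ {e S} → S e ≡ false → count (not ∘ insert e S) < count (not ∘ S)
  insert-count {e} {S} e∉S = count-mono-< fewer e (≡.cong not (insert-self e S)) (not-true e∉S)
    where
    fewer : ∀ f → not (insert e S f) ≡ true → not (S f) ≡ true
    fewer f q with S f
    ... | false = ≡.refl

  abstract
    -- Grown from `r` by one boundary edge at a time. Each new vertex comes with an edge that was
    -- not inside before, so the edge count in `size` keeps up with the vertex count.
    component : ∀ A r → Component A r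
    component A r = grow #V (r ==_) (==-refl r)
      (λ u p → ≡.subst (Walk _ r) (==⇒≡ p) nil)
      (≤-trans (≤-reflexive (count-singleton r)) (s≤s z≤n))
      (count≤ _)
      where
      grow : ∀ fuel (R : VertexSet) → R r ≡ true →
             (∀ u → R u ≡ true → Walk (λ e → A e ∧ inside R e) r u) →
             count R ≤ suc (count (λ e → A e ∧ inside R e)) →
             count (not ∘ R) ≤ fuel → Component A r
      grow fuel R r∈R reach size fuel≥ with search (λ e → A e ∧ boundary R e)
      ... | inj₂ none = record
        { members = R ; root = r∈R ; reach = reach ; size = size
        ; closed = λ {e} a j p → boundary-false R (unboundary e a) j p }
        where
        unboundary : ∀ e → A e ≡ true → boundary R e ≡ false
        unboundary e a with none e
        ... | eq rewrite a = eq
      ... | inj₁ (e , p) with boundary⇒leaves R e (∧-conicalʳ (A e) _ p)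
      ... | leaves {x} {y} j x∈ y∉ = continue fuel fuel≥
        where
        R′ : VertexSet
        R′ u = R u ∨ (y == u)
        R⊆ : ∀ u → R u ≡ true → R′ u ≡ true
        R⊆ u = ∨-introˡ
        y∈ : R′ y ≡ true
        y∈ = ∨-introʳ (R y) (==-refl y)
        widen : ∀ f → A f ∧ inside R f ≡ true → A f ∧ inside R′ f ≡ true
        widen f q = ∧-intro (∧-conicalˡ (A f) _ q) (inside-mono R⊆ f (∧-conicalʳ (A f) _ q))
        e∈ : A e ∧ inside R′ e ≡ true
        e∈ = ∧-intro (∧-conicalˡ (A e) _ p) (inside-intro j (R⊆ x x∈) y∈)
        e∉ : A e ∧ inside R e ≡ false
        e∉ with bool-cases (A e ∧ inside R e)
        ... | inj₂ q = q
        ... | inj₁ q = contradiction y∉ (true≢false (proj₂ (inside-ends R j (∧-conicalʳ (A e) _ q))))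
        reach′ : ∀ u → R′ u ≡ true → Walk (λ e → A e ∧ inside R′ e) r u
        reach′ u q with ∨-elim (R u) q
        ... | inj₁ u∈ = walk-mono widen (reach u u∈)
        ... | inj₂ y≡u = walk-mono widen (reach x x∈) ++ edgeWalk e∈ (≡.subst (Joins e x) (==⇒≡ y≡u) j)
        size′ : count R′ ≤ suc (count (λ e → A e ∧ inside R′ e))
        size′ = ≤-trans (count-∪ {P = y ==_} {Q = R} λ u q → swap (∨-elim (R u) q))
          (≤-trans (≤-reflexive (≡.cong (_+ count R) (count-singleton y)))
                   (s≤s (≤-trans size (count-mono-< widen e e∉ e∈))))
        shrink : count (not ∘ R′) < count (not ∘ R)
        shrink = count-mono-< fewer y (≡.cong not y∈) (not-true y∉)
          where
          fewer : ∀ u → not (R′ u) ≡ true → not (R u) ≡ true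
          fewer u q with R u
          ... | false = ≡.refl
        continue : ∀ fuel → count (not ∘ R) ≤ fuel → Component A r
        continue zero       f≥ = contradiction (≤-trans shrink f≥) λ ()
        continue (suc fuel) f≥ = grow fuel R′ (R⊆ r r∈R) reach′ size′ (≤-pred (≤-trans shrink f≥))

  -- If at most two edges left `X`, deleting them would have to keep the graph connected, yet no
  -- remaining edge would lead out of `X`.
  three-edges-leave : EdgeConnected 3 → ∀ (X : VertexSet) {u v} → X u ≡ true → X v ≡ false →
    ∃[ e₁ ] ∃[ e₂ ] ∃[ e₃ ] (Leaves X e₁ × Leaves X e₂ × Leaves X e₃ × e₁ ≢ e₂ × e₁ ≢ e₃ × e₂ ≢ e₃)
  three-edges-leave (_ , conn) X {u} {v} u∈ v∉ with 3 ≤? count (boundary X)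
  ... | yes 3≤ with e₁ , e₂ , e₃ , b₁ , b₂ , b₃ , distinct ← choose-three (boundary X) 3≤ =
    e₁ , e₂ , e₃ , boundary⇒leaves X e₁ b₁ , boundary⇒leaves X e₂ b₂ , boundary⇒leaves X e₃ b₃ , distinct
  ... | no 3≰ = contradiction v∉ (true≢false (stays (conn D small u v) u∈))
    where
    D = tabulate (boundary X)
    small : ∣ D ∣ < 3
    small = ≤-<-trans (≤-reflexive (∣tabulate∣≡count (boundary X))) (≰⇒> 3≰)
    stays : ∀ {x y} → EqClosure (ArcAvoiding D) x y → X x ≡ true → X y ≡ true
    stays εˢ p = p
    stays (fwd (e , e∉ , s , t) ◅ w) p = stays w (boundary-false X (∉-tabulate e∉) (inj₁ (s , t)) p)
    stays (bwd (e , e∉ , s , t) ◅ w) p = stays w (boundary-false X (∉-tabulate e∉) (inj₂ (s , t)) p)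

-- Spanning edge sets that leave two terminals joined

module Ears (G : OrientedGraph) (conn : OrientedGraph.EdgeConnected G 3) where
  open OrientedGraph G
  open Walks G

  joins-end : ∀ {e u v x y} (X : VertexSet) → Joins e u v → Joins e x y → X u ≡ true →
              X x ≡ true ⊎ X y ≡ true
  joins-end X (inj₁ (≡.refl , ≡.refl)) (inj₁ (≡.refl , ≡.refl)) p = inj₁ p
  joins-end X (inj₁ (≡.refl , ≡.refl)) (inj₂ (≡.refl , ≡.refl)) p = inj₂ p
  joins-end X (inj₂ (≡.refl , ≡.refl)) (inj₁ (≡.refl , ≡.refl)) p = inj₂ p
  joins-end X (inj₂ (≡.refl , ≡.refl)) (inj₂ (≡.refl , ≡.refl)) p = inj₁ p

  module Region (Q : VertexSet) (r : Vertex) (r∈Q : Q r ≡ true)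
                (connected : ∀ u → Q u ≡ true → Walk (inside Q) r u) where

    free : EdgeSet → EdgeSet
    free J e = inside Q e ∧ not (J e)

    -- The edges t₁ and t₂ of the idea, with the walk between their inner ends confined to `A`.
    record TwoTerminals (A : EdgeSet) : Set where
      constructor terminals
      field
        {e₁ e₂}  : Edge
        e₁≢e₂    : e₁ ≢ e₂
        leaves₁  : Leaves Q e₁
        leaves₂  : Leaves Q e₂
        walk     : Walk A (Leaves.inner leaves₁) (Leaves.inner leaves₂)

    -- The invariant under which `J` is enlarged until `M` is all of `Q`. The field `ends` is the
    -- one that an enlargement endangers, since it takes a free edge away.
    record State (J : EdgeSet) (M : VertexSet) : Set where
      field
        M⊆Q   : ∀ u → M u ≡ true → Q u ≡ true
        r∈M   : M r ≡ true
        reach : ∀ u → M u ≡ true → Walk J r u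
        J⊆M   : ∀ e → J e ≡ true → inside M e ≡ true
        ends  : TwoTerminals (free J)

    missing : VertexSet → VertexSet
    missing M u = Q u ∧ not (M u)

    module Extend {J M} (state : State J M) {w₀} (w₀∈ : missing M w₀ ≡ true)
                  (W-component : Component (inside (missing M)) w₀) where
      open State state

      rest : VertexSet
      rest = missing M

      rest-∉M : ∀ {u} → rest u ≡ true → M u ≡ false
      rest-∉M {u} p = not-elim (∧-conicalʳ (Q u) _ p)

      open Component W-component
        renaming (members to W; root to w₀∈W; reach to reachW; closed to closedW) hiding (size)

      W⊆rest : ∀ u → W u ≡ true → rest u ≡ true
      W⊆rest u p = walk-stays rest (λ e → ∧-conicalˡ (inside rest e) _) (reachW u p) w₀∈

      W∩M : ∀ {u} → M u ≡ true → W u ≡ false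
      W∩M {u} p with bool-cases (W u)
      ... | inj₂ q = q
      ... | inj₁ q = contradiction (rest-∉M (W⊆rest u q)) (true≢false p)

      -- The candidates for enlarging `J`: such an edge hangs `near` onto the part already spanned,
      -- at the cost of one free edge.
      record Link (f : Edge) : Set where
        constructor link
        field
          {near far} : Vertex
          joins      : Joins f near far
          near∈W     : W near ≡ true
          far∈M      : M far ≡ true

      F : EdgeSet
      F = free J

      -- Edges inside `W` have no end in `M`, hence are neither in `J` nor links. So `W` stays
      -- connected by free edges whichever link is taken away.
      within : ∀ {f u} → Link f → W u ≡ true → Walk (remove f F) u w₀
      within {f} {u} (link j w∈ m∈) u∈ = reverse (walk-mono keep (reachW u u∈))
        where
        keep : ∀ e → inside rest e ∧ inside W e ≡ true → remove f F e ≡ true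
        keep e p = remove-other {P = F}
          (∧-intro (inside-mono (λ v → ∧-conicalˡ (Q v) (not (M v))) e in-rest) (not-true e∉J)) f≢e
          where
          in-rest : inside rest e ≡ true
          in-rest = ∧-conicalˡ (inside rest e) _ p
          e∉J : J e ≡ false
          e∉J with bool-cases (J e)
          ... | inj₂ q = q
          ... | inj₁ q = contradiction (rest-∉M (∧-conicalˡ (rest (source e)) _ in-rest))
                                       (true≢false (∧-conicalˡ (M (source e)) _ (J⊆M e q)))
          f≢e : f ≢ e
          f≢e ≡.refl = contradiction (rest-∉M (proj₂ (inside-ends rest j in-rest))) (true≢false m∈)

      within² : ∀ {f u v} → Link f → W u ≡ true → W v ≡ true → Walk (remove f F) u v
      within² l u∈ v∈ = within l u∈ ++ reverse (within l v∈)

      record Exit (e : Edge) : Set where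
        constructor exit
        field
          leavesQ  : Leaves Q e
          inner∈W  : W (Leaves.inner leavesQ) ≡ true

      -- The outer end cannot lie in `Q` off `M`, because `W` is a whole component there.
      classify : ∀ {e} → Leaves W e → Exit e ⊎ Link e
      classify {e} (leaves {x} {y} j x∈ y∉) with bool-cases (Q y) | bool-cases (M y)
      ... | inj₂ y∉Q | _        = inj₁ (exit (leaves j (∧-conicalˡ (Q x) _ (W⊆rest x x∈)) y∉Q) x∈)
      ... | inj₁ _   | inj₁ y∈M = inj₂ (link j x∈ y∈M)
      ... | inj₁ y∈Q | inj₂ y∉M = contradiction y∉
        (true≢false (closedW (inside-intro j (W⊆rest x x∈) (∧-intro y∈Q (not-true y∉M))) j x∈))

      -- `Q` is connected and `r` lies in `M`, so a walk from `w₀` to `r` leaves `W` by an edge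
      -- inside `Q`, which cannot be an exit.
      some-link : ∃[ f ] Link f
      some-link with walk-leaves W (reverse (connected w₀ (∧-conicalˡ (Q w₀) _ w₀∈))) w₀∈W (W∩M r∈M)
      ... | e , e∈Q , l with classify l
      ... | inj₂ k = e , k
      ... | inj₁ (exit (leaves j _ y∉) _) =
        contradiction y∉ (true≢false (proj₂ (inside-ends Q j e∈Q)))

      off-link : ∀ {e f u v} → Joins e u v → W u ≡ false → W v ≡ false → Link f → f ≢ e
      off-link j u∉ v∉ (link k w∈ _) ≡.refl with joins-end W k j w∈
      ... | inj₁ u∈ = true≢false u∈ u∉
      ... | inj₂ v∈ = true≢false v∈ v∉

      -- A walk from u into W enters W through one link only, so every other link may be removed.
      Reaches : Vertex → Set
      Reaches u = ∃[ g ] (∀ f → Link f → f ≢ g → Walk (remove f F) u w₀)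

      reaches : ∀ {u v} → Walk F u v → (∀ f → Link f → Walk (remove f F) u v) ⊎ Reaches u
      reaches nil = inj₁ λ _ _ → nil
      reaches (step {u} {v} e e∈F j p) with bool-cases (W u) | bool-cases (W v)
      -- The start already lies in `W`: any link may be removed, and `e` is an arbitrary choice of
      -- exception.
      ... | inj₁ u∈ | _ = inj₂ (e , λ f l _ → within l u∈)
      ... | inj₂ _ | inj₁ v∈ = inj₂ (e , λ f l f≢e → step e (remove-other {P = F} e∈F f≢e) j (within l v∈))
      ... | inj₂ u∉ | inj₂ v∉ with reaches p
      ... | inj₁ h = inj₁ λ f l → step e (remove-other {P = F} e∈F (off-link j u∉ v∉ l)) j (h f l)
      ... | inj₂ (g , h) = inj₂ (g , λ f l f≢g →
        step e (remove-other {P = F} e∈F (off-link j u∉ v∉ l)) j (h f l f≢g))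

      Extendable : Set
      Extendable = ∃[ f ] (Link f × TwoTerminals (remove f F))

      -- Each of three edges leaving `W` is an exit or a link. Two exits are joined inside `W` and
      -- become the terminals. With fewer exits, either the old walk survives the removal of any
      -- link, or both of its ends reach `W`, each through at most one link, and a link can be
      -- spared: two links suffice if an exit replaces a terminal, three if none does.
      extendable : Extendable
      extendable with three-edges-leave conn W w₀∈W (W∩M r∈M) | ends
      ... | a , b , c , la , lb , lc , a≢b , a≢c , b≢c | terminals {e₁} {e₂} e₁≢e₂ t₁ t₂ walk =
        by-exits (classify la) (classify lb) (classify lc)
        where
        two-exits : ∀ {s t} → s ≢ t → Exit s → Exit t → Extendable
        two-exits s≢t (exit ls s∈) (exit lt t∈) with f , l ← some-link =
          f , l , terminals s≢t ls lt (within² l s∈ t∈)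

        avoid-one : ∀ {P : Edge → Set} {f h} → f ≢ h → P f → P h → ∀ g → ∃[ x ] (P x × x ≢ g)
        avoid-one {f = f} {h} f≢h pf ph g with f ≟ g
        ... | no f≢g   = f , pf , f≢g
        ... | yes ≡.refl = h , ph , f≢h ∘ ≡.sym

        one-exit : ∀ {s f h} → f ≢ h → Exit s → Link f → Link h → Extendable
        one-exit {s} {f} f≢h (exit ls s∈) lf lh with reaches walk | reaches (reverse walk)
        ... | inj₁ h | _      = f , lf , terminals e₁≢e₂ t₁ t₂ (h f lf)
        ... | _      | inj₁ h = f , lf , terminals (e₁≢e₂ ∘ ≡.sym) t₂ t₁ (h f lf)
        -- The exit `s` may itself be an old terminal; it is then paired with the other one.
        ... | inj₂ (g₁ , h₁) | inj₂ (g₂ , h₂) with e₁ ≟ s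
        ... | no e₁≢s with x , lx , x≢g ← avoid-one f≢h lf lh g₁ =
          x , lx , terminals e₁≢s t₁ ls (h₁ x lx x≢g ++ reverse (within lx s∈))
        ... | yes ≡.refl with x , lx , x≢g ← avoid-one f≢h lf lh g₂ =
          x , lx , terminals (e₁≢e₂ ∘ ≡.sym) t₂ ls (h₂ x lx x≢g ++ reverse (within lx s∈))

        avoid-two : Link a → Link b → Link c → ∀ g₁ g₂ → ∃[ x ] ((Link x × x ≢ g₁) × x ≢ g₂)
        avoid-two ka kb kc g₁ g₂ with a ≟ g₁ | b ≟ g₁
        ... | yes ≡.refl | _        = avoid-one b≢c (kb , a≢b ∘ ≡.sym) (kc , a≢c ∘ ≡.sym) g₂
        ... | no a≢g₁  | yes ≡.refl = avoid-one a≢c (ka , a≢g₁) (kc , b≢c ∘ ≡.sym) g₂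
        ... | no a≢g₁  | no b≢g₁  = avoid-one a≢b (ka , a≢g₁) (kb , b≢g₁) g₂

        no-exit : Link a → Link b → Link c → Extendable
        no-exit ka kb kc with reaches walk | reaches (reverse walk)
        ... | inj₁ h | _      = a , ka , terminals e₁≢e₂ t₁ t₂ (h a ka)
        ... | _      | inj₁ h = a , ka , terminals (e₁≢e₂ ∘ ≡.sym) t₂ t₁ (h a ka)
        ... | inj₂ (g₁ , h₁) | inj₂ (g₂ , h₂)
          with x , (lx , x≢g₁) , x≢g₂ ← avoid-two ka kb kc g₁ g₂ =
          x , lx , terminals e₁≢e₂ t₁ t₂ (h₁ x lx x≢g₁ ++ reverse (h₂ x lx x≢g₂))

        by-exits : Exit a ⊎ Link a → Exit b ⊎ Link b → Exit c ⊎ Link c → Extendable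
        by-exits (inj₁ xa) (inj₁ xb) _         = two-exits a≢b xa xb
        by-exits (inj₁ xa) (inj₂ _)  (inj₁ xc) = two-exits a≢c xa xc
        by-exits (inj₂ _)  (inj₁ xb) (inj₁ xc) = two-exits b≢c xb xc
        by-exits (inj₁ xa) (inj₂ kb) (inj₂ kc) = one-exit b≢c xa kb kc
        by-exits (inj₂ ka) (inj₁ xb) (inj₂ kc) = one-exit a≢c xb ka kc
        by-exits (inj₂ ka) (inj₂ kb) (inj₁ xc) = one-exit a≢b xc ka kb
        by-exits (inj₂ ka) (inj₂ kb) (inj₂ kc) = no-exit ka kb kc

      -- Giving `f` to `J` adds its end in `W` to `M`; the terminals stay joined because their walk
      -- was found without `f`.
      extend : Extendable → ∃[ J′ ] ∃[ M′ ] (State J′ M′ × count (missing M′) < count (missing M))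
      extend (f , link {w} {m} j w∈ m∈ , terminals e₁≢e₂ t₁ t₂ walk) =
        J′ , M′ , record
          { M⊆Q   = M′⊆Q
          ; r∈M   = ∨-introˡ r∈M
          ; reach = reach′
          ; J⊆M   = J′⊆M′
          ; ends  = terminals e₁≢e₂ t₁ t₂ (walk-mono kept walk)
          } , count-mono-< fewer w (gone w (∨-introʳ (M w) (==-refl w))) (W⊆rest w w∈)
        where
        J′ : EdgeSet
        J′ e = J e ∨ (f == e)
        M′ : VertexSet
        M′ u = M u ∨ (w == u)
        gone : ∀ u → M′ u ≡ true → missing M′ u ≡ false
        gone u p rewrite p with Q u
        ... | true  = ≡.refl
        ... | false = ≡.refl
        fewer : ∀ u → missing M′ u ≡ true → missing M u ≡ true
        fewer u p = ∧-intro (∧-conicalˡ (Q u) _ p) (weaken (∧-conicalʳ (Q u) _ p))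
          where
          weaken : not (M′ u) ≡ true → not (M u) ≡ true
          weaken q with M u
          ... | false = ≡.refl
        M′⊆Q : ∀ u → M′ u ≡ true → Q u ≡ true
        M′⊆Q u p with ∨-elim (M u) p
        ... | inj₁ u∈ = M⊆Q u u∈
        ... | inj₂ eq = ≡.subst (λ v → Q v ≡ true) (==⇒≡ eq) (∧-conicalˡ (Q w) _ (W⊆rest w w∈))
        reach′ : ∀ u → M′ u ≡ true → Walk J′ r u
        reach′ u p with ∨-elim (M u) p
        ... | inj₁ u∈ = walk-mono (λ _ → ∨-introˡ) (reach u u∈)
        ... | inj₂ eq = walk-mono (λ _ → ∨-introˡ) (reach m m∈)
          ++ edgeWalk (∨-introʳ (J f) (==-refl f)) (joins-sym (≡.subst (λ v → Joins f v m) (==⇒≡ eq) j))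
        J′⊆M′ : ∀ e → J′ e ≡ true → inside M′ e ≡ true
        J′⊆M′ e p with ∨-elim (J e) p
        ... | inj₁ e∈ = inside-mono {M} {M′} (λ _ → ∨-introˡ) e (J⊆M e e∈)
        ... | inj₂ eq = ≡.subst (λ g → inside M′ g ≡ true) (==⇒≡ eq)
          (inside-intro {M′} j (∨-introʳ (M w) (==-refl w)) (∨-introˡ m∈))
        kept : ∀ e → remove f F e ≡ true → free J′ e ≡ true
        kept e p with e∈F , f≢e ← remove-⊆ F f e p =
          ∧-intro (∧-conicalˡ (inside Q e) _ e∈F) (neither (∧-conicalʳ (inside Q e) _ e∈F))
          where
          neither : not (J e) ≡ true → not (J e ∨ (f == e)) ≡ true
          neither q with J e
          ... | false = not-true (≢⇒==-false f≢e)

    abstract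
      extension : ∀ {J M} → State J M → ∀ {u} → missing M u ≡ true →
                  ∃[ J′ ] ∃[ M′ ] (State J′ M′ × count (missing M′) < count (missing M))
      extension {M = M} state {u} p = from (component (inside (missing M)) u)
        where
        from : Component (inside (missing M)) u →
               ∃[ J′ ] ∃[ M′ ] (State J′ M′ × count (missing M′) < count (missing M))
        from W = Extend.extend state p W (Extend.extendable state p W)

    spanning : ∀ fuel {J M} → State J M → count (missing M) ≤ fuel →
               ∃[ J ] ∃[ M ] (State J M × (∀ u → Q u ≡ true → M u ≡ true))
    spanning fuel {J} {M} state fuel≥ with search (missing M)
    ... | inj₂ none = J , M , state , all
      where
      all : ∀ u → Q u ≡ true → M u ≡ true
      all u p with bool-cases (M u) | none u
      ... | inj₁ q | _ = q
      ... | inj₂ q | n rewrite p | q with () ← n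
    spanning zero    {J} {M} state fuel≥ | inj₁ (u , p)
      with J′ , M′ , _ , shrink ← extension state p with () ← ≤-trans shrink fuel≥
    spanning (suc fuel) state fuel≥ | inj₁ (u , p)
      with J′ , M′ , state′ , shrink ← extension state p =
      spanning fuel state′ (≤-pred (≤-trans shrink fuel≥))

    -- Starts from the empty `J`, which spans `r` alone and leaves every edge of `Q` free, and
    -- enlarges it until it spans `Q`. Free edges can then be deleted without disconnecting `Q`.
    nonseparating : TwoTerminals (inside Q) →
      ∃[ J ] ((∀ e → J e ≡ true → inside Q e ≡ true) × (∀ u → Q u ≡ true → Walk J r u) ×
              TwoTerminals (free J))
    nonseparating (terminals e₁≢e₂ t₁ t₂ walk)
      with J , M , state , all ← spanning _ {λ _ → false} {r ==_} (record
        { M⊆Q   = λ u p → ≡.subst (λ v → Q v ≡ true) (==⇒≡ p) r∈Q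
        ; r∈M   = ==-refl r
        ; reach = λ u p → ≡.subst (Walk _ r) (==⇒≡ p) nil
        ; J⊆M   = λ _ ()
        ; ends  = terminals e₁≢e₂ t₁ t₂ (walk-mono (λ e p → ∧-intro p ≡.refl) walk)
        }) ≤-refl =
      J , (λ e p → inside-mono (State.M⊆Q state) e (State.J⊆M state e p)) ,
      (λ u p → State.reach state u (all u p)) , State.ends state

-- The good edge set

module Closing (G : OrientedGraph) where
  open OrientedGraph G
  open Walks G

  -- `seed` admits edges of `C` for free; `s` counts only the closings, each of which later costs a
  -- factor in the number of flows. The last addition is innermost, which suits the backward
  -- induction in `steps-bound`.
  data Steps (C : EdgeSet) : EdgeSet → ℕ → Set where
    done   : ∀ {S} → (∀ e → S e ≡ true) → Steps C S 0
    seed   : ∀ {S S′ s} → (∀ e → S′ e ≡ true → S e ≡ true ⊎ C e ≡ true) →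
             Steps C S′ s → Steps C S s
    close₁ : ∀ {S s e u v} → S e ≡ false → Joins e u v → Walk S u v →
             Steps C (insert e S) s → Steps C S (suc s)
    close₂ : ∀ {S s e₁ e₂ u₁ v₁ u₂ v₂} → S e₁ ≡ false → S e₂ ≡ false → e₁ ≢ e₂ →
             Joins e₁ u₁ v₁ → Joins e₂ u₂ v₂ → Walk S u₁ u₂ → Walk S v₁ v₂ →
             Steps C (insert e₂ (insert e₁ S)) s → Steps C S (suc s)

  close-all : ∀ fuel {C S} → (∀ u v → Walk S u v) → count (not ∘ S) ≤ fuel →
              ∃[ s ] (Steps C S s × s ≤ count (not ∘ S))
  close-all fuel {C} {S} connected fuel≥ with search (not ∘ S)
  ... | inj₂ none = 0 , done (λ e → not-false (none e)) , z≤n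
  close-all zero {C} {S} connected fuel≥ | inj₁ (e , p)
    with () ← ≤-trans (insert-count {e} {S} (not-elim p)) fuel≥
  close-all (suc fuel) {C} {S} connected fuel≥ | inj₁ (e , p)
    with s , steps , s≤ ← close-all fuel {C} {insert e S}
           (λ u v → walk-mono (λ _ → ∨-introˡ) (connected u v))
           (≤-pred (≤-trans (insert-count {e} {S} (not-elim p)) fuel≥)) =
    suc s , close₁ (not-elim p) (inj₁ (≡.refl , ≡.refl)) (connected _ _) steps ,
    ≤-trans (s≤s s≤) (insert-count {e} {S} (not-elim p))

  -- The invariant of the growth of `X`: `S` has been reached, `C` is the part of the good set
  -- chosen so far. As both lie inside `X`, edges chosen later off `X` are disjoint from them.
  record Blob (X : VertexSet) (S C : EdgeSet) : Set where
    field
      r         : Vertex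
      r∈X       : X r ≡ true
      reach     : ∀ u → X u ≡ true → Walk S r u
      S⊆X       : ∀ e → S e ≡ true → inside X e ≡ true
      C⊆X       : ∀ e → C e ≡ true → inside X e ≡ true
      connected : ∀ u v → Walk (not ∘ C) u v

  -- By `bound` the closings number at most the missing edges less the missing vertices. Starting
  -- from a single vertex and no edges, this is |E| - |V| + 1.
  record Completion (X : VertexSet) (S C : EdgeSet) : Set where
    field
      {C′}      : EdgeSet
      {s}       : ℕ
      C⊆C′      : ∀ e → C e ≡ true → C′ e ≡ true
      steps     : Steps C′ S s
      connected : ∀ u v → Walk (not ∘ C′) u v
      bound     : s + count (not ∘ X) ≤ count (not ∘ S)

  module _ (conn : EdgeConnected 3) where
    open Ears G conn

    module Enlarge {X S C} (blob : Blob X S C) {y} (y∉X : X y ≡ false)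
                   (Q-component : Component (inside (not ∘ X)) y) where
      open Blob blob
      open Component Q-component
        renaming (members to Q; root to y∈Q; reach to reachQ; closed to closedQ) hiding (size)

      Q∩X : ∀ {u} → Q u ≡ true → X u ≡ false
      Q∩X {u} p = not-elim
        (walk-stays (not ∘ X) (λ e → ∧-conicalˡ (inside (not ∘ X) e) _) (reachQ u p) (not-true y∉X))

      X∩Q : ∀ {u} → X u ≡ true → Q u ≡ false
      X∩Q {u} p with bool-cases (Q u)
      ... | inj₂ q = q
      ... | inj₁ q = contradiction (Q∩X q) (true≢false p)

      connectedQ : ∀ u → Q u ≡ true → Walk (inside Q) y u
      connectedQ u p = walk-mono (λ e → ∧-conicalʳ (inside (not ∘ X) e) _) (reachQ u p)

      open Region Q y y∈Q connectedQ

      -- Were the outer end off `X`, the edge would belong to G - X and its outer end to the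
      -- component `Q`.
      outer∈X : ∀ {e} (l : Leaves Q e) → X (Leaves.outer l) ≡ true
      outer∈X (leaves {u} {v} j u∈ v∉) with bool-cases (X v)
      ... | inj₁ p = p
      ... | inj₂ p = contradiction v∉ (true≢false
        (closedQ (inside-intro {not ∘ X} j (not-true (Q∩X u∈)) (not-true p)) j u∈))

      two-terminals : TwoTerminals (inside Q)
      two-terminals with a , b , _ , la , lb , _ , a≢b , _ ← three-edges-leave conn Q y∈Q (X∩Q r∈X) =
        terminals a≢b la lb (reverse (connectedQ _ (Leaves.inner∈ la)) ++ connectedQ _ (Leaves.inner∈ lb))

      module Absorb {J} (J⊆Q : ∀ e → J e ≡ true → inside Q e ≡ true)
                    (reachJ : ∀ u → Q u ≡ true → Walk J y u) (T : TwoTerminals (free J))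
                    (R-component : Component (free J) (Leaves.inner (TwoTerminals.leaves₁ T))) where
        open TwoTerminals T renaming (leaves₁ to l₁; leaves₂ to l₂)
        open Component R-component
          renaming (members to R; root to root∈R; reach to reachR; size to sizeR) hiding (closed)
        open Leaves l₁ renaming (inner to q₁; outer to x₁; joins to j₁; inner∈ to q₁∈; outer∉ to x₁∉)
        open Leaves l₂ renaming (inner to q₂; outer to x₂; joins to j₂; inner∈ to q₂∈; outer∉ to x₂∉)

        -- One round of growth: the free edges `P` of the component `R` join `C` and are seeded, the
        -- two terminals are then closed together, and `X` grows by `R`.
        P S₁ S₂ S₃ C₁ : EdgeSet
        P e  = free J e ∧ inside R e
        S₁ e = S e ∨ P e
        S₂   = insert e₁ S₁
        S₃   = insert e₂ S₂
        C₁ e = C e ∨ P e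

        X₁ : VertexSet
        X₁ u = X u ∨ R u

        P⊆Q : ∀ e → P e ≡ true → inside Q e ≡ true
        P⊆Q e p = ∧-conicalˡ (inside Q e) _ (∧-conicalˡ (inside Q e ∧ not (J e)) _ p)

        Q-∉X : ∀ e → inside Q e ≡ true → inside X e ≡ false
        Q-∉X e p rewrite Q∩X (∧-conicalˡ (Q (source e)) _ p) = ≡.refl

        outside : ∀ {A : EdgeSet} {Y : VertexSet} → (∀ e → A e ≡ true → inside Y e ≡ true) →
                  ∀ e → inside Y e ≡ false → A e ≡ false
        outside {A} h e q with bool-cases (A e)
        ... | inj₂ p = p
        ... | inj₁ p = contradiction q (true≢false (h e p))

        terminal∉ : ∀ {e} → Leaves Q e → S₁ e ≡ false
        terminal∉ {e} (leaves {u} {v} j u∈ v∉) with bool-cases (S₁ e)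
        ... | inj₂ p = p
        ... | inj₁ p with ∨-elim (S e) p
        ...   | inj₁ q = contradiction (Q∩X u∈) (true≢false (proj₁ (inside-ends X j (S⊆X e q))))
        ...   | inj₂ q = contradiction v∉ (true≢false (proj₂ (inside-ends Q j (P⊆Q e q))))

        e₁∉S₁ : S₁ e₁ ≡ false
        e₁∉S₁ = terminal∉ l₁

        e₂∉S₁ : S₁ e₂ ≡ false
        e₂∉S₁ = terminal∉ l₂

        e₂∉S₂ : S₂ e₂ ≡ false
        e₂∉S₂ rewrite e₂∉S₁ = ≢⇒==-false e₁≢e₂

        S⊆S₁ : ∀ e → S e ≡ true → S₁ e ≡ true
        S⊆S₁ e = ∨-introˡ

        P⊆S₁ : ∀ e → P e ≡ true → S₁ e ≡ true
        P⊆S₁ e = ∨-introʳ (S e)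

        S₂⊆S₃ : ∀ e → S₂ e ≡ true → S₃ e ≡ true
        S₂⊆S₃ e = ∨-introˡ

        S₁⊆S₃ : ∀ e → S₁ e ≡ true → S₃ e ≡ true
        S₁⊆S₃ e p = S₂⊆S₃ e (∨-introˡ p)

        q₂∈R : R q₂ ≡ true
        q₂∈R = component-walk R-component walk root∈R

        X⊆X₁ : ∀ u → X u ≡ true → X₁ u ≡ true
        X⊆X₁ u = ∨-introˡ

        R⊆X₁ : ∀ u → R u ≡ true → X₁ u ≡ true
        R⊆X₁ u = ∨-introʳ (X u)

        reach₁ : ∀ u → X₁ u ≡ true → Walk S₃ r u
        reach₁ u p with ∨-elim (X u) p
        ... | inj₁ u∈X = walk-mono (λ e → S₁⊆S₃ e ∘ S⊆S₁ e) (reach u u∈X)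
        ... | inj₂ u∈R =
          walk-mono (λ e → S₁⊆S₃ e ∘ S⊆S₁ e) (reach x₁ (outer∈X l₁)) ++
          edgeWalk (S₂⊆S₃ e₁ (insert-self e₁ S₁)) (joins-sym j₁) ++
          walk-mono (λ e → S₁⊆S₃ e ∘ P⊆S₁ e) (reachR u u∈R)

        terminal-inside : ∀ {e} (l : Leaves Q e) → R (Leaves.inner l) ≡ true → inside X₁ e ≡ true
        terminal-inside l q∈R =
          inside-intro {X₁} (Leaves.joins l) (R⊆X₁ _ q∈R) (X⊆X₁ _ (outer∈X l))

        S₃⊆X₁ : ∀ e → S₃ e ≡ true → inside X₁ e ≡ true
        S₃⊆X₁ e p with ∨-elim (S₂ e) p
        ... | inj₂ eq = ≡.subst (λ f → inside X₁ f ≡ true) (==⇒≡ eq) (terminal-inside l₂ q₂∈R)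
        ... | inj₁ p with ∨-elim (S₁ e) p
        ... | inj₂ eq = ≡.subst (λ f → inside X₁ f ≡ true) (==⇒≡ eq) (terminal-inside l₁ root∈R)
        ... | inj₁ p with ∨-elim (S e) p
        ... | inj₁ q = inside-mono {X} {X₁} X⊆X₁ e (S⊆X e q)
        ... | inj₂ q = inside-mono {R} {X₁} R⊆X₁ e (∧-conicalʳ (inside Q e ∧ not (J e)) _ q)

        C₁⊆X₁ : ∀ e → C₁ e ≡ true → inside X₁ e ≡ true
        C₁⊆X₁ e p with ∨-elim (C e) p
        ... | inj₁ q = inside-mono {X} {X₁} X⊆X₁ e (C⊆X e q)
        ... | inj₂ q = inside-mono {R} {X₁} R⊆X₁ e (∧-conicalʳ (inside Q e ∧ not (J e)) _ q)

        J∩C₁ : ∀ e → J e ≡ true → not (C₁ e) ≡ true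
        J∩C₁ e p rewrite outside {C} {X} C⊆X e (Q-∉X e (J⊆Q e p)) | p with inside Q e
        ... | true  = ≡.refl
        ... | false = ≡.refl

        -- An edge newly put into `C` has both ends in `Q`, where `J` provides a detour: it spans
        -- `Q` and is disjoint from `C₁`.
        connected₁ : ∀ u v → Walk (not ∘ C₁) u v
        connected₁ u v = walk-bind detour (connected u v)
          where
          detour : ∀ e {u v} → not (C e) ≡ true → Joins e u v → Walk (not ∘ C₁) u v
          detour e {u} {v} e∉C j with bool-cases (P e)
          ... | inj₂ e∉P = edgeWalk keep j
            where
            keep : not (C₁ e) ≡ true
            keep rewrite not-elim e∉C | e∉P = ≡.refl
          ... | inj₁ e∈P with u∈ , v∈ ← inside-ends Q j (P⊆Q e e∈P) =
            walk-mono J∩C₁ (reverse (reachJ u u∈) ++ reachJ v v∈)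

        blob₁ : Blob X₁ S₃ C₁
        blob₁ = record
          { r = r ; r∈X = X⊆X₁ r r∈X ; reach = reach₁ ; S⊆X = S₃⊆X₁ ; C⊆X = C₁⊆X₁
          ; connected = connected₁ }

        shrink : count (not ∘ X₁) < count (not ∘ X)
        shrink = count-mono-< fewer q₁ (≡.cong not (R⊆X₁ q₁ root∈R)) (not-true (Q∩X q₁∈))
          where
          fewer : ∀ u → not (X₁ u) ≡ true → not (X u) ≡ true
          fewer u q with X u
          ... | false = ≡.refl

        completion : Completion X₁ S₃ C₁ → Completion X S C
        completion K = record
          { C⊆C′  = λ e p → C⊆C′ e (∨-introˡ p)
          -- The terminals lie on a common closed walk: their inner ends are joined in `P`, their
          -- outer ends in `S` by way of `r`.
          ; steps = seed split (close₂ e₁∉S₁ e₂∉S₁ e₁≢e₂ j₁ j₂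
              (walk-mono P⊆S₁ (reachR q₂ q₂∈R))
              (walk-mono S⊆S₁ (reverse (reach x₁ (outer∈X l₁)) ++ reach x₂ (outer∈X l₂))) steps)
          ; connected = connected′
          ; bound = bound′
          }
          where
          open Completion K renaming (connected to connected′)
          split : ∀ e → S₁ e ≡ true → S e ≡ true ⊎ C′ e ≡ true
          split e p with ∨-elim (S e) p
          ... | inj₁ q = inj₁ q
          ... | inj₂ q = inj₂ (C⊆C′ e (∨-introʳ (C e) q))
          X-split : count (not ∘ X) ≤ count R + count (not ∘ X₁)
          X-split = count-∪ {P = R} {Q = not ∘ X₁} cover
            where
            cover : ∀ u → not (X u) ≡ true → R u ≡ true ⊎ not (X₁ u) ≡ true
            cover u p with X u | R u
            ... | false | true  = inj₁ ≡.refl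
            ... | false | false = inj₂ ≡.refl
          S-split : count P + count (not ∘ S₁) ≤ count (not ∘ S)
          S-split = count-disjoint {P = P} {Q = not ∘ S₁}
            (λ e p → not-true (outside {S} {X} S⊆X e (Q-∉X e (P⊆Q e p))))
            fewer (λ e p → ≡.cong not (P⊆S₁ e p))
            where
            fewer : ∀ e → not (S₁ e) ≡ true → not (S e) ≡ true
            fewer e q with S e
            ... | false = ≡.refl
          S₃-count : 2 + count (not ∘ S₃) ≤ count (not ∘ S₁)
          S₃-count = ≤-trans (s≤s (insert-count {e₂} {S₂} e₂∉S₂)) (insert-count {e₁} {S₁} e₁∉S₁)
          -- A round uses |P| + 2 edges for one closing and at most |R| new vertices, and |R| ≤ |P|
          -- + 1.
          bound′ : suc s + count (not ∘ X) ≤ count (not ∘ S)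
          bound′ = begin
            suc s + count (not ∘ X)               ≤⟨ +-monoʳ-≤ (suc s) X-split ⟩
            suc s + (count R + count (not ∘ X₁))  ≤⟨ +-monoʳ-≤ (suc s) (+-monoˡ-≤ _ sizeR) ⟩
            suc s + (suc (count P) + count (not ∘ X₁)) ≡⟨ rearrange s (count P) _ ⟩
            count P + (2 + (s + count (not ∘ X₁)))  ≤⟨ +-monoʳ-≤ (count P) (s≤s (s≤s bound)) ⟩
            count P + (2 + count (not ∘ S₃))        ≤⟨ +-monoʳ-≤ (count P) S₃-count ⟩
            count P + count (not ∘ S₁)              ≤⟨ S-split ⟩
            count (not ∘ S)                         ∎
            where
            open ≤-Reasoning
            open +-*-Solver
            rearrange : ∀ s p x → suc s + (suc p + x) ≡ p + (2 + (s + x))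
            rearrange = solve 3 (λ s p x → (con 1 :+ s) :+ ((con 1 :+ p) :+ x)
                                        := p :+ (con 2 :+ (s :+ x))) ≡.refl

      enlarge : (∀ {X₁ S₁ C₁} → Blob X₁ S₁ C₁ → count (not ∘ X₁) < count (not ∘ X) →
                 Completion X₁ S₁ C₁) → Completion X S C
      enlarge rec = from (nonseparating two-terminals)
        where
        from : (∃[ J ] ((∀ e → J e ≡ true → inside Q e ≡ true) × (∀ u → Q u ≡ true → Walk J y u) ×
                TwoTerminals (free J))) → Completion X S C
        from (J , J⊆Q , reachJ , T) = completion (rec blob₁ shrink)
          where open Absorb J⊆Q reachJ T (component _ _)

    -- Recursion on the number of vertices outside `X`. Once there are none, `S` joins all vertices
    -- and every remaining edge can be closed by itself.
    complete : ∀ fuel {X S C} → Blob X S C → count (not ∘ X) ≤ fuel → Completion X S C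
    complete fuel {X} {S} {C} blob fuel≥ with search (not ∘ X)
    ... | inj₂ none = finish (close-all _ {C} {S} spans ≤-refl)
      where
      spans : ∀ u v → Walk S u v
      spans u v = reverse (Blob.reach blob u (not-false (none u))) ++ Blob.reach blob v (not-false (none v))
      finish : ∃[ s ] (Steps C S s × s ≤ count (not ∘ S)) → Completion X S C
      finish (s , steps , s≤) = record
        { C⊆C′ = λ e p → p ; steps = steps ; connected = Blob.connected blob
        ; bound = ≤-trans (≤-reflexive (≡.trans (≡.cong (λ z → s + z) (count-none _ none)) (+-comm s 0))) s≤ }
    complete fuel {X} blob fuel≥ | inj₁ (y , y∉) =
      Enlarge.enlarge blob (not-elim y∉) (component _ _) (recurse fuel fuel≥)
      where
      recurse : ∀ fuel → count (not ∘ X) ≤ fuel → ∀ {X₁ S₁ C₁} → Blob X₁ S₁ C₁ →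
                count (not ∘ X₁) < count (not ∘ X) → Completion X₁ S₁ C₁
      recurse zero       f≥ b lt with () ← ≤-trans lt f≥
      recurse (suc fuel) f≥ b lt = complete fuel b (≤-pred (≤-trans lt f≥))

    -- Both bounds are the cycle rank |E| - |V| + 1, written additively because subtraction on ℕ
    -- truncates.
    record Decomposition : Set where
      field
        C         : EdgeSet
        s         : ℕ
        steps     : Steps C (λ _ → false) s
        connected : ∀ u v → Walk (not ∘ C) u v
        s-bound   : s + #V ≤ suc #E
        C-bound   : count C + #V ≤ suc #E

    decomposition : Vertex → Decomposition
    decomposition r = from (complete _ blob ≤-refl) (λ C → component (not ∘ C) r)
      where
      blob : Blob (r ==_) (λ _ → false) (λ _ → false)
      blob = record
        { r = r ; r∈X = ==-refl r
        ; reach = λ u p → ≡.subst (Walk _ r) (==⇒≡ p) nil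
        ; S⊆X = λ _ () ; C⊆X = λ _ ()
        ; connected = λ u v → walk-mono (λ _ _ → ≡.refl) (walk-between u v)
        }
        where
        walk-between : ∀ u v → Walk (λ _ → true) u v
        walk-between u v = walk-of (component (λ _ → true) u)
          where
          walk-of : Component (λ _ → true) u → Walk (λ _ → true) u v
          walk-of K with bool-cases (Component.members K v)
          ... | inj₁ p = walk-mono (λ _ _ → ≡.refl) (Component.reach K v p)
          -- `G` is connected: edges leave every nonempty proper vertex set, but none leaves a
          -- component.
          ... | inj₂ p with e , _ , _ , leaves j x∈ y∉ , _
                         ← three-edges-leave conn (Component.members K) (Component.root K) p =
            contradiction y∉ (true≢false (Component.closed K ≡.refl j x∈))
      from : Completion (r ==_) (λ _ → false) (λ _ → false) →
             (∀ C → Component (not ∘ C) r) → Decomposition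
      from K comp = record
        { C = C′ ; s = s ; steps = steps ; connected = connected
        ; s-bound = s-bound ; C-bound = C-bound }
        where
        open Completion K
        open Component (comp C′) using (members; root; size)
        vertices : #V ≡ suc (count (not ∘ (r ==_)))
        vertices = ≡.trans (≡.sym (count-full {#V} (λ _ → true) λ _ → ≡.refl))
                         (count-remove (λ _ → true) r ≡.refl)
        edges : count (not ∘ (λ (_ : Edge) → false)) ≡ #E
        edges = count-full {#E} (λ _ → true) λ _ → ≡.refl
        s-bound : s + #V ≤ suc #E
        s-bound = ≤-trans (≤-reflexive (≡.trans (≡.cong (λ z → s + z) vertices) (+-suc s _)))
                          (s≤s (≤-trans bound (≤-reflexive edges)))
        all-members : ∀ v → members v ≡ true
        all-members v = component-walk (comp C′) (connected r v) root
        C-bound : count C′ + #V ≤ suc #E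
        -- The graph without `C′` is connected and so keeps at least |V| - 1 edges.
        C-bound = begin
          count C′ + #V            ≡⟨ ≡.cong (λ z → count C′ + z) (count-full members all-members) ⟨
          count C′ + count members ≤⟨ +-monoʳ-≤ (count C′) size ⟩
          count C′ + suc (count (λ e → not (C′ e) ∧ inside members e)) ≡⟨ +-suc _ _ ⟩
          suc (count C′ + count (λ e → not (C′ e) ∧ inside members e))
            ≤⟨ s≤s (count-disjoint {P = C′} {Q = λ e → not (C′ e) ∧ inside members e} {R = λ _ → true}
                     (λ _ _ → ≡.refl) (λ _ _ → ≡.refl) apart) ⟩
          suc (count (λ (_ : Edge) → true)) ≡⟨ ≡.cong suc edges ⟩
          suc #E ∎
          where
          open ≤-Reasoning
          apart : ∀ e → C′ e ≡ true → not (C′ e) ∧ inside members e ≡ false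
          apart e p rewrite p = ≡.refl

-- Group-valued chains

module Sums (Γ : AbelianGroup c ρ) where
  open AbelianGroup Γ
  open AbelianGroupProperties Γ using (⁻¹-∙-comm; ε⁻¹≈ε)
  open CommutativeSemigroupProperties commutativeSemigroup using (x∙yz≈y∙xz)
  open Summation commutativeMonoid public using (sum; sum-cong-≋; ∑-distrib-+; ∑-comm; sum-replicate-zero)
  open SetoidReasoning setoid

  sum-ε : (g : Fin n → Carrier) → (∀ i → g i ≈ ε) → sum g ≈ ε
  sum-ε {n} g h = trans (sum-cong-≋ h) (sum-replicate-zero n)

  sum-only : (g : Fin n → Carrier) (i : Fin n) → (∀ j → i ≢ j → g j ≈ ε) → sum g ≈ g i
  sum-only g zero    h = trans (∙-congˡ (sum-ε (g ∘ suc) λ j → h (suc j) λ ())) (identityʳ _)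
  sum-only g (suc i) h =
    trans (∙-cong (h zero λ ()) (sum-only (g ∘ suc) i λ j i≢j → h (suc j) (i≢j ∘ suc-injective)))
          (identityˡ _)

  sum-split : (g : Fin n → Carrier) (i : Fin n) → sum g ≈ g i ∙ sum (updateAt g i (const ε))
  sum-split g zero    = ∙-congˡ (sym (identityˡ _))
  sum-split g (suc i) = trans (∙-congˡ (sum-split (g ∘ suc) i)) (x∙yz≈y∙xz _ _ _)

  -- Made for rerouting, where the terms of two edges change individually but not in total.
  sum-exchange : (g h : Fin n → Carrier) {i j : Fin n} → i ≢ j →
                 (∀ k → k ≢ i → k ≢ j → g k ≈ h k) → g i ∙ g j ≈ h i ∙ h j → sum g ≈ sum h
  sum-exchange g h {i} {j} i≢j agree eq = begin
    sum g                 ≈⟨ split g ⟩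
    (g i ∙ g j) ∙ sum (clear g) ≈⟨ ∙-cong eq (sum-cong-≋ cleared) ⟩
    (h i ∙ h j) ∙ sum (clear h) ≈⟨ split h ⟨
    sum h                 ∎
    where
    clear : (Fin _ → Carrier) → Fin _ → Carrier
    clear f = updateAt (updateAt f i (const ε)) j (const ε)
    split : ∀ f → sum f ≈ (f i ∙ f j) ∙ sum (clear f)
    split f = begin
      sum f                                                     ≈⟨ sum-split f i ⟩
      f i ∙ sum (updateAt f i (const ε))                        ≈⟨ ∙-congˡ (sum-split _ j) ⟩
      f i ∙ (updateAt f i (const ε) j ∙ sum (clear f))
        ≡⟨ ≡.cong (λ x → f i ∙ (x ∙ sum (clear f))) (updateAt-minimal j i f (i≢j ∘ ≡.sym)) ⟩
      f i ∙ (f j ∙ sum (clear f))                               ≈⟨ assoc _ _ _ ⟨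
      (f i ∙ f j) ∙ sum (clear f)                               ∎
    cleared : ∀ k → clear g k ≈ clear h k
    cleared k with k ≟ j
    ... | yes ≡.refl = reflexive (≡.trans (updateAt-updates j _) (≡.sym (updateAt-updates j _)))
    ... | no k≢j with k ≟ i
    ...   | yes ≡.refl = reflexive (≡.trans (drop g) (≡.sym (drop h)))
      where
      drop : ∀ f → clear f k ≡ ε
      drop f = ≡.trans (updateAt-minimal k j _ k≢j) (updateAt-updates k f)
    ...   | no k≢i = trans (reflexive (keep g)) (trans (agree k k≢i k≢j) (reflexive (≡.sym (keep h))))
      where
      keep : ∀ f → clear f k ≡ f k
      keep f = ≡.trans (updateAt-minimal k j _ k≢j) (updateAt-minimal k i f k≢i)

  sum-⁻¹ : (g : Fin n → Carrier) → sum (λ i → g i ⁻¹) ≈ sum g ⁻¹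
  sum-⁻¹ {zero}  g = sym ε⁻¹≈ε
  sum-⁻¹ {suc n} g = trans (∙-congˡ (sum-⁻¹ (g ∘ suc))) (⁻¹-∙-comm _ _)

  -- A point mass, in the exact shape of the summands of `outflow` and `inflow`.
  χ : Fin n → Carrier → Fin n → Carrier
  χ u x v = if ⌊ u ≟ v ⌋ then x else ε

  χ-self : (u : Fin n) {x : Carrier} → χ u x u ≈ x
  χ-self u with u ≟ u
  ... | yes _   = refl
  ... | no  u≢u = contradiction ≡.refl u≢u

  χ-other : {u v : Fin n} {x : Carrier} → u ≢ v → χ u x v ≈ ε
  χ-other {u = u} {v} u≢v with u ≟ v
  ... | yes u≡v = contradiction u≡v u≢v
  ... | no  _   = refl

  χ-cong : (u v : Fin n) {x y : Carrier} → x ≈ y → χ u x v ≈ χ u y v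
  χ-cong u v x≈y with u ≟ v
  ... | yes _ = x≈y
  ... | no  _ = refl

  χ-∙ : (u v : Fin n) (x y : Carrier) → χ u (x ∙ y) v ≈ χ u x v ∙ χ u y v
  χ-∙ u v x y with u ≟ v
  ... | yes _ = refl
  ... | no  _ = sym (identityˡ ε)

  χ-ε : (u v : Fin n) → χ u ε v ≈ ε
  χ-ε u v with u ≟ v
  ... | yes _ = refl
  ... | no  _ = refl

  χ-⁻¹ : (u v : Fin n) (x : Carrier) → χ u (x ⁻¹) v ≈ χ u x v ⁻¹
  χ-⁻¹ u v x with u ≟ v
  ... | yes _ = refl
  ... | no  _ = sym ε⁻¹≈ε

  sum-χ : (u : Fin n) (x : Carrier) → sum (χ u x) ≈ x
  sum-χ u x = trans (sum-only (χ u x) u λ j → χ-other) (χ-self u)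

module Chains (Γ : AbelianGroup c ρ) (G : OrientedGraph) where
  open AbelianGroup Γ
  open AbelianGroupProperties Γ using (⁻¹-∙-comm; ⁻¹-involutive; ε⁻¹≈ε; x∙y⁻¹≈ε⇒x≈y; x≈y⇒x∙y⁻¹≈ε)
  open CommutativeSemigroupProperties commutativeSemigroup using (interchange)
  open Sums Γ
  open OrientedGraph G
  open Walks G
  open Flows G Γ
  open SetoidReasoning setoid

  Chain : Set c
  Chain = Edge → Carrier

  -- The divergence at `w` of `x` units sent from `u` to `v`. Its endpoints need not span an edge,
  -- so divergences along a walk telescope.
  arc : Vertex → Vertex → Carrier → Vertex → Carrier
  arc u v x w = χ u x w ∙ χ v x w ⁻¹

  ∂ : Chain → Vertex → Carrier
  ∂ φ w = sum (λ e → arc (source e) (target e) (φ e) w)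

  arc-cong : ∀ u v w {x y} → x ≈ y → arc u v x w ≈ arc u v y w
  arc-cong u v w x≈y = ∙-cong (χ-cong u w x≈y) (⁻¹-cong (χ-cong v w x≈y))

  arc-∙ : ∀ u v w x y → arc u v (x ∙ y) w ≈ arc u v x w ∙ arc u v y w
  arc-∙ u v w x y = begin
    χ u (x ∙ y) w ∙ χ v (x ∙ y) w ⁻¹ ≈⟨ ∙-cong (χ-∙ u w x y) (⁻¹-cong (χ-∙ v w x y)) ⟩
    (χ u x w ∙ χ u y w) ∙ (χ v x w ∙ χ v y w) ⁻¹ ≈⟨ ∙-congˡ (⁻¹-∙-comm _ _) ⟨
    (χ u x w ∙ χ u y w) ∙ (χ v x w ⁻¹ ∙ χ v y w ⁻¹) ≈⟨ interchange _ _ _ _ ⟩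
    arc u v x w ∙ arc u v y w ∎

  arc-ε : ∀ u v w → arc u v ε w ≈ ε
  arc-ε u v w = trans (∙-cong (χ-ε u w) (trans (⁻¹-cong (χ-ε v w)) ε⁻¹≈ε)) (identityˡ ε)

  arc-⁻¹ : ∀ u v w x → arc u v (x ⁻¹) w ≈ arc v u x w
  arc-⁻¹ u v w x = begin
    χ u (x ⁻¹) w ∙ χ v (x ⁻¹) w ⁻¹ ≈⟨ ∙-cong (χ-⁻¹ u w x) (trans (⁻¹-cong (χ-⁻¹ v w x)) (⁻¹-involutive _)) ⟩
    χ u x w ⁻¹ ∙ χ v x w           ≈⟨ comm _ _ ⟩
    arc v u x w                    ∎

  arc-loop : ∀ u w x → arc u u x w ≈ ε
  arc-loop u w x = inverseʳ _

  arc-compose : ∀ u v w x y → arc u v x y ∙ arc v w x y ≈ arc u w x y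
  arc-compose u v w x y = begin
    (χ u x y ∙ χ v x y ⁻¹) ∙ (χ v x y ∙ χ w x y ⁻¹) ≈⟨ assoc _ _ _ ⟩
    χ u x y ∙ (χ v x y ⁻¹ ∙ (χ v x y ∙ χ w x y ⁻¹)) ≈⟨ ∙-congˡ (assoc _ _ _) ⟨
    χ u x y ∙ ((χ v x y ⁻¹ ∙ χ v x y) ∙ χ w x y ⁻¹) ≈⟨ ∙-congˡ (∙-congʳ (inverseˡ _)) ⟩
    χ u x y ∙ (ε ∙ χ w x y ⁻¹)                      ≈⟨ ∙-congˡ (identityˡ _) ⟩
    arc u w x y                                     ∎

  ∂-cong : ∀ {φ ψ} → (∀ e → φ e ≈ ψ e) → ∀ v → ∂ φ v ≈ ∂ ψ v
  ∂-cong h v = sum-cong-≋ λ e → arc-cong (source e) (target e) v (h e)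

  ∂-∙ : ∀ φ ψ v → ∂ (λ e → φ e ∙ ψ e) v ≈ ∂ φ v ∙ ∂ ψ v
  ∂-∙ φ ψ v = trans (sum-cong-≋ λ e → arc-∙ (source e) (target e) v (φ e) (ψ e))
                    (∑-distrib-+ (λ e → arc (source e) (target e) (φ e) v) _)

  ∂-ε : ∀ v → ∂ (λ _ → ε) v ≈ ε
  ∂-ε v = sum-ε _ λ e → arc-ε (source e) (target e) v

  ∂-sum : (g : Fin n → Chain) → ∀ v → ∂ (λ e → sum (λ i → g i e)) v ≈ sum (λ i → ∂ (g i) v)
  ∂-sum {zero}  g v = ∂-ε v
  ∂-sum {suc n} g v = trans (∂-∙ (g zero) _ v) (∙-congˡ (∂-sum (g ∘ suc) v))

  ∂-χ : ∀ e x v → ∂ (χ e x) v ≈ arc (source e) (target e) x v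
  ∂-χ e x v = trans
    (sum-only _ e λ f e≢f → trans (arc-cong (source f) (target f) v (χ-other e≢f)) (arc-ε (source f) (target f) v))
    (arc-cong (source e) (target e) v (χ-self e))

  -- Each edge contributes its value at one end and the inverse at the other. Conservation at one
  -- vertex thus follows from conservation at the rest.
  sum-∂ : ∀ φ → sum (∂ φ) ≈ ε
  sum-∂ φ = trans (∑-comm (λ v e → arc (source e) (target e) (φ e) v)) (sum-ε _ λ e → begin
    sum (λ v → arc (source e) (target e) (φ e) v)
      ≈⟨ ∑-distrib-+ (χ (source e) (φ e)) _ ⟩
    sum (χ (source e) (φ e)) ∙ sum (λ v → χ (target e) (φ e) v ⁻¹)
      ≈⟨ ∙-cong (sum-χ (source e) (φ e)) (trans (sum-⁻¹ (χ (target e) (φ e))) (⁻¹-cong (sum-χ (target e) (φ e)))) ⟩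
    φ e ∙ φ e ⁻¹ ≈⟨ inverseʳ _ ⟩
    ε ∎)

  private
    ∂≈outflow-inflow : ∀ φ v → ∂ φ v ≈ outflow φ v ∙ inflow φ v ⁻¹
    ∂≈outflow-inflow φ v =
      trans (∑-distrib-+ (λ e → χ (source e) (φ e) v) (λ e → χ (target e) (φ e) v ⁻¹))
            (∙-congˡ (sum-⁻¹ λ e → χ (target e) (φ e) v))

  flow⇒∂ : ∀ {φ} → IsFlow φ → ∀ v → ∂ φ v ≈ ε
  flow⇒∂ h v = trans (∂≈outflow-inflow _ v) (x≈y⇒x∙y⁻¹≈ε (h v))

  ∂⇒flow : ∀ {φ} → (∀ v → ∂ φ v ≈ ε) → IsFlow φ
  ∂⇒flow h v = x∙y⁻¹≈ε⇒x≈y _ _ (trans (sym (∂≈outflow-inflow _ v)) (h v))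

  -- The value to put on `e` in order to send `x` from `u` to `v`, whichever way `e` points.
  orient : ∀ {e u v} → Joins e u v → Carrier → Carrier
  orient (inj₁ _) x = x
  orient (inj₂ _) x = x ⁻¹

  arc-orient : ∀ {e u v} (j : Joins e u v) x w → arc (source e) (target e) (orient j x) w ≈ arc u v x w
  arc-orient (inj₁ (≡.refl , ≡.refl)) x w = refl
  arc-orient {e} (inj₂ (≡.refl , ≡.refl)) x w = arc-⁻¹ (source e) (target e) w x

  walkChain : ∀ {A u v} → Walk A u v → Carrier → Chain
  walkChain nil            x f = ε
  walkChain (step e _ j p) x f = χ e (orient j x) f ∙ walkChain p x f

  ∂-walk : ∀ {A u v} (p : Walk A u v) x w → ∂ (walkChain p x) w ≈ arc u v x w
  ∂-walk {u = u} nil x w = trans (∂-ε w) (sym (arc-loop u w x))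
  ∂-walk {u = u} {v} (step {v = y} e e∈A j p) x w = begin
    ∂ (walkChain (step e e∈A j p) x) w                      ≈⟨ ∂-∙ (χ e (orient j x)) (walkChain p x) w ⟩
    ∂ (χ e (orient j x)) w ∙ ∂ (walkChain p x) w
      ≈⟨ ∙-cong (trans (∂-χ e _ w) (arc-orient j x w)) (∂-walk p x w) ⟩
    arc u y x w ∙ arc y v x w                              ≈⟨ arc-compose u y v x w ⟩
    arc u v x w                                            ∎

  walkChain-support : ∀ {A u v} (p : Walk A u v) x f → A f ≡ false → walkChain p x f ≈ ε
  walkChain-support nil x f f∉A = refl
  walkChain-support (step e e∈A j p) x f f∉A =
    trans (∙-cong (χ-other {u = e} {f} λ { ≡.refl → true≢false e∈A f∉A }) (walkChain-support p x f f∉A)) (identityˡ ε)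

-- Eulerian orientations

-- The edge set is kept, so chains on the two graphs are the same functions.
retarget : (G : OrientedGraph) → OrientedGraph.Edge G → OrientedGraph.Vertex G → OrientedGraph
retarget G e w = record G { target = updateAt (OrientedGraph.target G) e (const w) }

module Reroute (Γ : AbelianGroup c ρ) (G : OrientedGraph) where
  open AbelianGroup Γ
  open Sums Γ
  open OrientedGraph G
  open Walks G
  open Chains Γ G
  open SetoidReasoning setoid

  -- What `φ` sends along the retargeted `e₀`, `ψ` sends along the original `e₀` and on through
  -- `e₁`; at the vertex in between the contributions cancel.
  ∂-reroute : ∀ {e₀ e₁ w} → e₀ ≢ e₁ → (j : Joins e₁ (target e₀) w) (φ ψ : Chain) →
              φ e₁ ≈ ε → (∀ e → e ≢ e₁ → ψ e ≈ φ e) → ψ e₁ ≈ orient j (φ e₀) →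
              ∀ x → ∂ ψ x ≈ Chains.∂ Γ (retarget G e₀ w) φ x
  ∂-reroute {e₀} {e₁} {w} e₀≢e₁ j φ ψ φ₁ agree ψ₁ x =
    sum-exchange (λ e → arc (source e) (target e) (ψ e) x)
                 (λ e → arc (source e) (target′ e) (φ e) x) e₀≢e₁
      (λ e e≢e₀ e≢e₁ → trans (arc-cong (source e) (target e) x (agree e e≢e₁))
        (reflexive (≡.cong (λ y → arc (source e) y (φ e) x) (≡.sym (updateAt-minimal e e₀ target e≢e₀)))))
      (begin
        arc (source e₀) (target e₀) (ψ e₀) x ∙ arc (source e₁) (target e₁) (ψ e₁) x
          ≈⟨ ∙-cong (arc-cong (source e₀) (target e₀) x (agree e₀ e₀≢e₁))
                    (trans (arc-cong (source e₁) (target e₁) x ψ₁) (arc-orient j (φ e₀) x)) ⟩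
        arc (source e₀) (target e₀) (φ e₀) x ∙ arc (target e₀) w (φ e₀) x
          ≈⟨ arc-compose (source e₀) (target e₀) w (φ e₀) x ⟩
        arc (source e₀) w (φ e₀) x
          ≡⟨ ≡.cong (λ y → arc (source e₀) y (φ e₀) x) (≡.sym (updateAt-updates e₀ target)) ⟩
        arc (source e₀) (target′ e₀) (φ e₀) x
          ≈⟨ identityʳ _ ⟨
        arc (source e₀) (target′ e₀) (φ e₀) x ∙ ε
          ≈⟨ ∙-congˡ (trans (arc-cong (source e₁) (target′ e₁) x φ₁) (arc-ε (source e₁) (target′ e₁) x)) ⟨
        arc (source e₀) (target′ e₀) (φ e₀) x ∙ arc (source e₁) (target′ e₁) (φ e₁) x ∎)
    where
    target′ : Edge → Vertex
    target′ = updateAt target e₀ (const w)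

  ∂-drop-loop : ∀ {e} → source e ≡ target e → (φ ψ : Chain) → (∀ f → f ≢ e → φ f ≈ ψ f) →
                ∀ x → ∂ φ x ≈ ∂ ψ x
  ∂-drop-loop {e} loop φ ψ agree x = sum-cong-≋ same
    where
    at-loop : ∀ y → arc (source e) (target e) y x ≈ ε
    at-loop y = trans (reflexive (≡.cong (λ u → arc u (target e) y x) loop)) (arc-loop (target e) x y)
    same : ∀ f → arc (source f) (target f) (φ f) x ≈ arc (source f) (target f) (ψ f) x
    same f with f ≟ e
    ... | yes ≡.refl = trans (at-loop (φ e)) (sym (at-loop (ψ e)))
    ... | no f≢e     = arc-cong (source f) (target f) x (agree f f≢e)

odd : Parity → Bool
odd 0ℙ = false
odd 1ℙ = true

odd⇒≡1ℙ : ∀ {p} → odd p ≡ true → p ≡ 1ℙ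
odd⇒≡1ℙ {1ℙ} _ = ≡.refl

¬odd⇒≡0ℙ : ∀ {p} → odd p ≡ false → p ≡ 0ℙ
¬odd⇒≡0ℙ {0ℙ} _ = ≡.refl

module Orientation (Γ : AbelianGroup c ρ) (a : AbelianGroup.Carrier Γ) where
  open AbelianGroup Γ
  open AbelianGroupProperties Γ using (⁻¹-involutive)

  Signed : Parity → Carrier → Set ρ
  Signed 0ℙ x = x ≈ ε
  Signed 1ℙ x = x ≈ a ⊎ x ≈ a ⁻¹

  signed-orient : ∀ {G e u v x} (j : Walks.Joins G e u v) → Signed 1ℙ x →
                  Signed 1ℙ (Chains.orient Γ G j x)
  signed-orient (inj₁ _) p        = p
  signed-orient (inj₂ _) (inj₁ p) = inj₂ (⁻¹-cong p)
  signed-orient (inj₂ _) (inj₂ p) = inj₁ (trans (⁻¹-cong p) (⁻¹-involutive a))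

  module Z (G : OrientedGraph) = Chains +-0-abelianGroup G
  module D (G : OrientedGraph) = Chains Γ G

  -- An Eulerian orientation of the support of `ψ`, in the form of the flow that sends `a` along it.
  Lift : (G : OrientedGraph) → (OrientedGraph.Edge G → Parity) → Set (c ⊔ ρ)
  Lift G ψ = ∃[ σ ] ((∀ e → Signed (ψ e) (σ e)) × (∀ v → D.∂ G σ v ≈ ε))

  drop-count : ∀ {n} (ψ : Fin n → Parity) e → ψ e ≡ 1ℙ →
               count (odd ∘ updateAt ψ e (const 0ℙ)) < count (odd ∘ ψ)
  drop-count ψ e p = count-mono-< fewer e (≡.cong odd (updateAt-updates e ψ)) (≡.cong odd p)
    where
    fewer : ∀ f → odd (updateAt ψ e (const 0ℙ) f) ≡ true → odd (ψ f) ≡ true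
    fewer f q with f ≟ e
    ... | yes ≡.refl = ≡.cong odd p
    ... | no f≢e     = ≡.trans (≡.cong odd (≡.sym (updateAt-minimal f e ψ f≢e))) q

  -- As `e₀` is no loop, it contributes 1 at its target; with no other odd edge there the sum could
  -- not vanish.
  second-edge : (G : OrientedGraph) → let open OrientedGraph G in
    (ψ : Edge → Parity) → (∀ v → Z.∂ G ψ v ≡ 0ℙ) →
    ∀ e₀ → ψ e₀ ≡ 1ℙ → source e₀ ≢ target e₀ →
    ∃[ e₁ ] (e₀ ≢ e₁ × ψ e₁ ≡ 1ℙ × (∃[ w ] Walks.Joins G e₁ (target e₀) w))
  second-edge G ψ closed e₀ ψ₀ non-loop with search other
    where
    open OrientedGraph G
    other : Fin #E → Bool
    other e = odd (ψ e) ∧ (not (e₀ == e) ∧ ((source e == target e₀) ∨ (target e == target e₀)))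
  ... | inj₁ (e₁ , p) = e₁ , e₀≢e₁ , odd⇒≡1ℙ (∧-conicalˡ (odd (ψ e₁)) _ p) , at (∨-elim _ ends)
    where
    open OrientedGraph G
    rest : not (e₀ == e₁) ∧ ((source e₁ == target e₀) ∨ (target e₁ == target e₀)) ≡ true
    rest = ∧-conicalʳ (odd (ψ e₁)) _ p
    ends = ∧-conicalʳ (not (e₀ == e₁)) _ rest
    e₀≢e₁ : e₀ ≢ e₁
    e₀≢e₁ ≡.refl = true≢false (==-refl e₀) (not-elim (∧-conicalˡ (not (e₀ == e₁)) _ rest))
    at : (source e₁ == target e₀) ≡ true ⊎ (target e₁ == target e₀) ≡ true →
         ∃[ w ] Walks.Joins G e₁ (target e₀) w
    at (inj₁ q) = target e₁ , inj₁ (==⇒≡ q , ≡.refl)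
    at (inj₂ q) = source e₁ , inj₂ (≡.refl , ==⇒≡ q)
  ... | inj₂ none = contradiction (≡.trans (≡.sym total) (closed v)) λ ()
    where
    open OrientedGraph G
    open Sums +-0-abelianGroup using (sum-only; χ-self; χ-other)
    v = target e₀
    vanish : ∀ e → e₀ ≢ e → Z.arc G (source e) (target e) (ψ e) v ≡ 0ℙ
    vanish e e₀≢e with ψ e | none e
    ... | 0ℙ | _ = Z.arc-ε G (source e) (target e) v
    ... | 1ℙ | q with source e ≟ v | target e ≟ v
    ...   | no _  | no _  = ≡.refl
    ...   | yes _ | _     rewrite ≢⇒==-false e₀≢e with () ← q
    ...   | no _  | yes _ rewrite ≢⇒==-false e₀≢e with () ← q
    total : Z.∂ G ψ v ≡ 1ℙ
    total = ≡.trans (sum-only (λ e → Z.arc G (source e) (target e) (ψ e) v) e₀ vanish) at-e₀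
      where
      at-e₀ : Z.arc G (source e₀) v (ψ e₀) v ≡ 1ℙ
      at-e₀ rewrite ψ₀ with source e₀ ≟ v | v ≟ v
      ... | yes loop | _ = contradiction loop non-loop
      ... | no _ | yes _ = ≡.refl
      ... | no _ | no v≢v = contradiction ≡.refl v≢v

  -- Two ψ-edges at a vertex v are merged into one edge bypassing v, and the sign found for the
  -- merged edge is given back to both of them.
  lift : ∀ fuel (G : OrientedGraph) (ψ : OrientedGraph.Edge G → Parity) →
         (∀ v → Z.∂ G ψ v ≡ 0ℙ) → count (odd ∘ ψ) ≤ fuel → Lift G ψ
  lift fuel G ψ closed fuel≥ with search (odd ∘ ψ)
  ... | inj₂ none = (λ _ → ε) , (λ e → ≡.subst (λ p → Signed p ε) (≡.sym (¬odd⇒≡0ℙ (none e))) refl) , D.∂-ε G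
  lift zero G ψ closed fuel≥ | inj₁ (e₀ , p) with () ← ≤-trans (drop-count ψ e₀ (odd⇒≡1ℙ p)) fuel≥
  lift (suc fuel) G ψ closed fuel≥ | inj₁ (e₀ , p) with OrientedGraph.source G e₀ ≟ OrientedGraph.target G e₀
  ... | yes loop = from (lift fuel G ψ′
          (λ v → ≡.trans (Reroute.∂-drop-loop +-0-abelianGroup G loop ψ′ ψ
                            (λ f f≢ → updateAt-minimal f e₀ ψ f≢) v) (closed v))
          (≤-pred (≤-trans (drop-count ψ e₀ (odd⇒≡1ℙ p)) fuel≥)))
    where
    ψ′ = updateAt ψ e₀ (const 0ℙ)
    from : Lift G ψ′ → Lift G ψ
    from (σ , signed , ∂σ) = σ′ , signed′ , λ v →
      trans (Reroute.∂-drop-loop Γ G loop σ′ σ (λ f f≢ → reflexive (updateAt-minimal f e₀ σ f≢)) v) (∂σ v)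
      where
      -- A loop does not affect conservation, so either sign would do.
      σ′ = updateAt σ e₀ (const a)
      signed′ : ∀ e → Signed (ψ e) (σ′ e)
      signed′ e with e ≟ e₀
      ... | yes ≡.refl rewrite odd⇒≡1ℙ p = inj₁ (reflexive (updateAt-updates e₀ σ))
      ... | no e≢ = ≡.subst₂ Signed (updateAt-minimal e e₀ ψ e≢) (≡.sym (updateAt-minimal e e₀ σ e≢)) (signed e)
  ... | no non-loop = from-second (second-edge G ψ closed e₀ (odd⇒≡1ℙ p) non-loop)
    where
    open OrientedGraph G
    from-second : ∃[ e₁ ] (e₀ ≢ e₁ × ψ e₁ ≡ 1ℙ × (∃[ w ] Walks.Joins G e₁ (target e₀) w)) → Lift G ψ
    -- In the retargeted graph `e₀` stands for the merged edge and `e₁` drops out of the support, so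
    -- the number of odd edges falls.
    from-second (e₁ , e₀≢e₁ , ψ₁ , w , j) = from (lift fuel (retarget G e₀ w) ψ′
        (λ v → ≡.trans (≡.sym (Reroute.∂-reroute +-0-abelianGroup G e₀≢e₁ j ψ′ ψ (updateAt-updates e₁ ψ)
                 (λ e e≢ → ≡.sym (updateAt-minimal e e₁ ψ e≢)) (oriented j) v)) (closed v))
        (≤-pred (≤-trans (drop-count ψ e₁ ψ₁) fuel≥)))
      where
      ψ′ = updateAt ψ e₁ (const 0ℙ)
      ψ′₀ : ψ′ e₀ ≡ 1ℙ
      ψ′₀ = ≡.trans (updateAt-minimal e₀ e₁ ψ e₀≢e₁) (odd⇒≡1ℙ p)
      -- Negation in ℤ₂ is the identity, so both directions of `e₁` are alike here.
      oriented : (k : Walks.Joins G e₁ (target e₀) w) → ψ e₁ ≡ Z.orient G k (ψ′ e₀)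
      oriented (inj₁ _) = ≡.trans ψ₁ (≡.sym ψ′₀)
      oriented (inj₂ _) = ≡.trans ψ₁ (≡.sym ψ′₀)
      from : Lift (retarget G e₀ w) ψ′ → Lift G ψ
      from (σ , signed , ∂σ) = σ′ , signed′ , λ v →
        trans (Reroute.∂-reroute Γ G e₀≢e₁ j σ σ′ σ₁
                 (λ e e≢ → reflexive (updateAt-minimal e e₁ σ e≢)) (reflexive (updateAt-updates e₁ σ)) v) (∂σ v)
        where
        σ′ = updateAt σ e₁ (const (D.orient G j (σ e₀)))
        σ₁ : σ e₁ ≈ ε
        σ₁ = ≡.subst (λ q → Signed q (σ e₁)) (updateAt-updates e₁ ψ) (signed e₁)
        signed′ : ∀ e → Signed (ψ e) (σ′ e)
        signed′ e with e ≟ e₁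
        ... | yes ≡.refl = ≡.subst₂ Signed (≡.sym ψ₁) (≡.sym (updateAt-updates e₁ σ))
              (signed-orient {G} j (≡.subst (λ q → Signed q (σ e₀)) ψ′₀ (signed e₀)))
        ... | no e≢ = ≡.subst₂ Signed (updateAt-minimal e e₁ ψ e≢) (≡.sym (updateAt-minimal e e₁ σ e≢)) (signed e)

-- Counting chains

funToFin-cong : (f g : Fin m → Fin n) → (∀ i → f i ≡ g i) → funToFin f ≡ funToFin g
funToFin-cong {zero}  f g h = ≡.refl
funToFin-cong {suc m} f g h = ≡.cong₂ combine (h zero) (funToFin-cong (f ∘ suc) (g ∘ suc) (h ∘ suc))

-- Distinct hit elements have distinct chosen preimages, so at most `m` elements are hit, even when
-- `bad` repeats values.
avoiding : (bad : Fin m → Fin n) →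
           ∃[ j ] (Injective _≡_ _≡_ j × (∀ (i : Fin (n ∸ m)) l → j i ≢ bad l))
avoiding {m} {n} bad = j ,
  (λ eq → inject≤-injective room room _ _ (enumerate-injective (not ∘ hit) eq)) , avoids
  where
  hit? : ∀ x → Dec (∃[ l ] bad l ≡ x)
  hit? x = any? λ l → bad l ≟ x
  hit : BoolSubset n
  hit x = does (hit? x)
  source-of : ∀ i → ∃[ l ] bad l ≡ enumerate hit i
  source-of i = does-true (hit? (enumerate hit i)) (enumerate-∈ hit i)
  few : count hit ≤ m
  few = injective⇒≤ {f = proj₁ ∘ source-of} λ {i} {k} eq → enumerate-injective hit
    (≡.trans (≡.sym (proj₂ (source-of i))) (≡.trans (≡.cong bad eq) (proj₂ (source-of k))))
  room : n ∸ m ≤ count (not ∘ hit)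
  room = m≤n+o⇒m∸n≤o n m (≤-trans
    (≤-reflexive (≡.sym (count-full {n} (λ _ → true) λ _ → ≡.refl)))
    (≤-trans (count-∪ {P = hit} {Q = not ∘ hit} {R = λ _ → true} cover)
             (+-monoˡ-≤ (count (not ∘ hit)) few)))
    where
    cover : ∀ x → true ≡ true → hit x ≡ true ⊎ not (hit x) ≡ true
    cover x _ with hit x
    ... | true  = inj₁ ≡.refl
    ... | false = inj₂ ≡.refl
  j : Fin (n ∸ m) → Fin n
  j i = enumerate (not ∘ hit) (inject≤ i room)
  avoids : ∀ i l → j i ≢ bad l
  avoids i l eq = does-false (hit? (j i)) (not-elim (enumerate-∈ (not ∘ hit) (inject≤ i room))) (l , ≡.sym eq)

-- Flows with values 0, a and -a, prescribed on `C`

module Prescribe (Γ : AbelianGroup c ρ) (G : OrientedGraph) (a : AbelianGroup.Carrier Γ) where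
  open AbelianGroup Γ
  open OrientedGraph G
  open Walks G
  open Chains Γ G using (Chain; ∂)
  module Z₂ = Chains +-0-abelianGroup G
  open Sums +-0-abelianGroup using (sum; sum-ε; sum-only; χ; χ-self; χ-other)

  Shift : Chain → Edge → Set ρ
  Shift φ e = φ e ≈ ε ⊎ φ e ≈ a ⊎ φ e ≈ a ⁻¹

  record Prescribed (C X : EdgeSet) : Set (c ⊔ ρ) where
    field
      chain   : Chain
      closed  : ∀ v → ∂ chain v ≈ ε
      small   : ∀ e → Shift chain e
      shifted : ∀ e → C e ≡ true → X e ≡ true → chain e ≈ a ⊎ chain e ≈ a ⁻¹
      still   : ∀ e → C e ≡ true → X e ≡ false → chain e ≈ ε

  abstract
    -- Take the ℤ₂-sum, over the edges of `C` in `X`, of cycles made of the edge and a walk back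
    -- outside `C`. Each cycle meets `C` in its own edge only, so the sum restricts on `C` to the
    -- indicator of `X`. An Eulerian orientation of its support gives the flow.
    prescribe : ∀ C → (∀ u v → Walk (not ∘ C) u v) → ∀ X → Prescribed C X
    prescribe C connected X = from (Orientation.lift Γ a _ G ψ ∂ψ ≤-refl)
      where
      weight : Bool → Parity
      weight true  = 1ℙ
      weight false = 0ℙ
      x : Edge → Parity
      x e = weight (C e ∧ X e)
      -- For `e` not in both `C` and `X` the weight `x e` is zero and the cycle vanishes, so the sum
      -- may range over all edges.
      cycle : Edge → Edge → Parity
      cycle e f = χ e (x e) f +ℙ Z₂.walkChain (connected (target e) (source e)) (x e) f
      ψ : Edge → Parity
      ψ f = sum (λ e → cycle e f)
      ∂-cycle : ∀ e v → Z₂.∂ (cycle e) v ≡ 0ℙ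
      ∂-cycle e v = ≡.trans (Z₂.∂-∙ (χ e (x e)) _ v)
        (≡.trans (≡.cong₂ _+ℙ_ (Z₂.∂-χ e (x e) v) (Z₂.∂-walk (connected (target e) (source e)) (x e) v))
        (≡.trans (Z₂.arc-compose (source e) (target e) (source e) (x e) v) (Z₂.arc-loop (source e) v (x e))))
      ∂ψ : ∀ v → Z₂.∂ ψ v ≡ 0ℙ
      ∂ψ v = ≡.trans (Z₂.∂-sum cycle v) (sum-ε _ λ e → ∂-cycle e v)
      ψ-on-C : ∀ f → C f ≡ true → ψ f ≡ x f
      ψ-on-C f f∈C = ≡.trans (sum-only (λ e → cycle e f) f λ e f≢e →
          ≡.cong₂ _+ℙ_ (χ-other (f≢e ∘ ≡.sym)) (away e))
        (≡.trans (≡.cong₂ _+ℙ_ (χ-self f) (away f)) (+-identityʳ (x f)))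
        where
        away : ∀ e → Z₂.walkChain (connected (target e) (source e)) (x e) f ≡ 0ℙ
        away e = Z₂.walkChain-support (connected (target e) (source e)) (x e) f (≡.cong not f∈C)
      from : Orientation.Lift Γ a G ψ → Prescribed C X
      from (σ , signed , ∂σ) = record
        { chain = σ ; closed = ∂σ
        ; small = λ e → shift (ψ e) (signed e)
        ; shifted = λ e e∈C e∈X → ≡.subst (λ w → Signed w (σ e))
            (≡.trans (ψ-on-C e e∈C) (≡.cong₂ (λ y z → weight (y ∧ z)) e∈C e∈X)) (signed e)
        ; still = λ e e∈C e∉X → ≡.subst (λ w → Signed w (σ e))
            (≡.trans (ψ-on-C e e∈C) (≡.cong₂ (λ y z → weight (y ∧ z)) e∈C e∉X)) (signed e)
        }
        where
        open Orientation Γ a using (Signed)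
        shift : ∀ w {y} → Signed w y → y ≈ ε ⊎ y ≈ a ⊎ y ≈ a ⁻¹
        shift 0ℙ s = inj₁ s
        shift 1ℙ s = inj₂ s

-- Cardinalities of decidable sets of group-valued vectors

module ChainCounting (Γ : AbelianGroup c ρ) {k : ℕ}
                     (finite : HasCardinality (AbelianGroup.setoid Γ) k) (m : ℕ) where
  open AbelianGroup Γ
  open AbelianGroupProperties Γ using (∙-cancelʳ)
  open SetoidReasoning setoid
  open Inverse finite using () renaming
    (to to enc; from to dec; to-cong to enc-cong; strictlyInverseˡ to enc-dec; strictlyInverseʳ to dec-enc)

  Vector : Set c
  Vector = Fin m → Carrier

  _≋_ : Vector → Vector → Set ρ
  φ ≋ ψ = ∀ e → φ e ≈ ψ e

  _≈?_ : ∀ x y → Dec (x ≈ y)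
  x ≈? y = map′ (λ eq → trans (sym (dec-enc x)) (trans (reflexive (≡.cong dec eq)) (dec-enc y)))
                enc-cong (enc x ≟ enc y)

  code : Vector → Fin (k ^ℕ m)
  code φ = funToFin (enc ∘ φ)

  decode : Fin (k ^ℕ m) → Vector
  decode i = dec ∘ finToFun i

  decode-code : ∀ φ → decode (code φ) ≋ φ
  decode-code φ e = trans (reflexive (≡.cong dec (finToFun-funToFin (enc ∘ φ) e))) (dec-enc (φ e))

  code-decode : ∀ i → code (decode i) ≡ i
  code-decode i = ≡.trans (funToFin-cong {m} _ _ (λ e → enc-dec (finToFun i e))) (funToFin-finToFin {m} i)

  code-cong : ∀ {φ ψ} → φ ≋ ψ → code φ ≡ code ψ
  code-cong h = funToFin-cong _ _ (enc-cong ∘ h)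

  -- `resp` allows the property to be tested on the decoded representative of a vector.
  record DecidableProperty p : Set (c ⊔ ρ ⊔ Level.suc p) where
    field
      Holds : Vector → Set p
      holds? : ∀ φ → Dec (Holds φ)
      resp : ∀ {φ ψ} → φ ≋ ψ → Holds φ → Holds ψ

  open DecidableProperty

  members : DecidableProperty p → BoolSubset (k ^ℕ m)
  members P i = does (holds? P (decode i))

  # : DecidableProperty p → ℕ
  # P = count (members P)

  element : (P : DecidableProperty p) → Fin (# P) → Vector
  element P i = decode (enumerate (members P) i)

  element-holds : (P : DecidableProperty p) (i : Fin (# P)) → Holds P (element P i)
  element-holds P i = does-true (holds? P _) (enumerate-∈ (members P) i)

  element-injective : (P : DecidableProperty p) {i j : Fin (# P)} → element P i ≋ element P j → i ≡ j
  element-injective P h = enumerate-injective (members P)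
    (≡.trans (≡.sym (code-decode _)) (≡.trans (code-cong h) (code-decode _)))

  private
    located : (P : DecidableProperty p) (φ : Vector) → Holds P φ →
              ∃[ i ] enumerate (members P) i ≡ code φ
    located P φ h = rank (members P) (code φ)
      (dec-true (holds? P _) (resp P (λ e → sym (decode-code φ e)) h))

  index : (P : DecidableProperty p) (φ : Vector) → Holds P φ → Fin (# P)
  index P φ h = proj₁ (located P φ h)

  element-index : (P : DecidableProperty p) (φ : Vector) (h : Holds P φ) → element P (index P φ h) ≋ φ
  element-index P φ h e = trans (reflexive (≡.cong (λ i → decode i e) (proj₂ (located P φ h)))) (decode-code φ e)

  cardinality : (P : DecidableProperty p) →
    HasCardinality (On.setoid {B = Σ Vector (Holds P)} (VectorEquality.≋-setoid setoid m) proj₁) (# P)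
  cardinality P = record
    { to        = λ (φ , h) → index P φ h
    ; from      = λ i → element P i , element-holds P i
    -- `index` receives the proof as well; equal vectors still get equal indices because `element`
    -- is injective.
    ; to-cong   = λ {x} {y} φ≋ψ → unique (λ e → trans (element-index P (proj₁ x) (proj₂ x) e)
                    (trans (φ≋ψ e) (sym (element-index P (proj₁ y) (proj₂ y) e))))
    ; from-cong = λ { ≡.refl e → refl }
    ; inverse   = (λ {i} {x} h → unique (λ e → trans (element-index P (proj₁ x) (proj₂ x) e) (h e)))
                , (λ { {x} {i} ≡.refl e → element-index P (proj₁ x) (proj₂ x) e })
    }
    where
    unique : ∀ {i j} → element P i ≋ element P j → i ≡ j
    unique = element-injective P

  #-mono : (P : DecidableProperty p) (Q : DecidableProperty q) →
           (∀ φ → Holds P φ → Holds Q φ) → # P ≤ # Q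
  #-mono P Q h = count-mono {P = members P} {Q = members Q} λ i p →
    dec-true (holds? Q _) (h _ (does-true (holds? P _) p))

  #-full : (P : DecidableProperty p) → (∀ φ → Holds P φ) → # P ≡ k ^ℕ m
  #-full P h = count-full (members P) λ i → dec-true (holds? P _) (h _)

  -- The pair (j i , φ ∙ L (j i)) determines first φ and then i.
  #-shift : (P : DecidableProperty p) (Q : DecidableProperty q) (d b : ℕ) (L : Fin b → Vector) →
            (∀ φ → Holds P φ → ∃[ j ] (Injective _≡_ _≡_ j ×
               (∀ (i : Fin d) → Holds Q (λ e → φ e ∙ L (j i) e)))) →
            d *ℕ # P ≤ b *ℕ # Q
  #-shift P Q d b L h = injective⇒≤ {f = f} f-injective
    where
    jump : Fin (# P) → Fin d → Fin b
    jump x = proj₁ (h (element P x) (element-holds P x))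
    image : (i : Fin d) (x : Fin (# P)) → Fin (# Q)
    image i x = index Q _ (proj₂ (proj₂ (h (element P x) (element-holds P x))) i)
    g : Fin d × Fin (# P) → Fin (b *ℕ # Q)
    g (i , x) = combine (jump x i) (image i x)
    same-element : ∀ {i x l y} → jump x i ≡ jump y l → image i x ≡ image l y → x ≡ y
    same-element {i} {x} {l} {y} same-jump same-image = element-injective P λ e →
      ∙-cancelʳ (L (jump y l) e) _ _ (begin
        element P x e ∙ L (jump y l) e ≡⟨ ≡.cong (λ z → element P x e ∙ L z e) same-jump ⟨
        element P x e ∙ L (jump x i) e ≈⟨ element-index Q _ _ e ⟨
        element Q (image i x) e        ≡⟨ ≡.cong (λ z → element Q z e) same-image ⟩
        element Q (image l y) e        ≈⟨ element-index Q _ _ e ⟩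
        element P y e ∙ L (jump y l) e ∎)
    g-injective : ∀ {u v} → g u ≡ g v → u ≡ v
    g-injective {i , x} {l , y} eq
      with same-jump , same-image ← combine-injective (jump x i) (image i x) (jump y l) (image l y) eq
      with ≡.refl ← same-element {i} {x} {l} {y} same-jump same-image =
      ≡.cong (_, x) (proj₁ (proj₂ (h (element P x) (element-holds P x))) same-jump)
    f : Fin (d *ℕ # P) → Fin (b *ℕ # Q)
    f z = g (remQuot (# P) z)
    f-injective : Injective _≡_ _≡_ f
    f-injective {y} {z} eq = ≡.trans (≡.sym (combine-remQuot {d} (# P) y))
      (≡.trans (≡.cong (λ (i , x) → combine i x) (g-injective eq)) (combine-remQuot {d} (# P) z))

fin1-injective : (j : Fin 1 → Fin n) → Injective _≡_ _≡_ j
fin1-injective j {zero} {zero} _ = ≡.refl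

-- Inequalities between numbers of flows

module FlowCounting (G : OrientedGraph) (Γ : AbelianGroup c ρ) {k : ℕ}
                    (finite : HasCardinality (AbelianGroup.setoid Γ) k) where
  open AbelianGroup Γ
  open AbelianGroupProperties Γ using (ε⁻¹≈ε; ⁻¹-involutive; //-rightDividesʳ; ∙-cancelˡ)
  open Sums Γ
  open OrientedGraph G
  open Walks G
  open Flows G Γ using (IsFlow)
  open Chains Γ G
  open Closing G using (Steps; done; seed; close₁; close₂)
  open ChainCounting Γ finite #E
  open Inverse finite using () renaming
    (to to enc; from to dec; to-cong to enc-cong; strictlyInverseˡ to enc-dec; strictlyInverseʳ to dec-enc)

  Closed : Chain → Set ρ
  Closed φ = ∀ v → ∂ φ v ≈ ε

  closed-∙ : ∀ {φ ψ} → Closed φ → Closed ψ → Closed (λ e → φ e ∙ ψ e)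
  closed-∙ hφ hψ v = trans (∂-∙ _ _ v) (trans (∙-cong (hφ v) (hψ v)) (identityˡ ε))

  flows : DecidableProperty ρ
  flows = record
    { Holds = Closed
    ; holds? = λ φ → all? λ v → ∂ φ v ≈? ε
    ; resp = λ h closed v → trans (sym (∂-cong h v)) (closed v) }

  chains : DecidableProperty 0ℓ
  chains = record { Holds = λ _ → ⊤ ; holds? = λ _ → yes tt ; resp = λ _ p → p }

  -- Correcting a chain along walks to r makes it a flow, at the cost of |V| - 1 group elements.
  flows-lower : (r : Vertex) → (∀ u v → Walk (λ _ → true) u v) →
                k ^ℕ #E ≤ k ^ℕ count (remove r (λ _ → true)) *ℕ # flows
  flows-lower r connected = ≤-trans (≤-reflexive (≡.trans (≡.sym (#-full chains λ _ → tt)) (≡.sym (*-identityˡ _))))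
    (#-shift chains flows 1 _ L λ φ _ → (λ _ → funToFin (residue φ)) , fin1-injective _ , λ _ → corrected φ)
    where
    others : VertexSet
    others = remove r (λ _ → true)
    other : Fin (count others) → Vertex
    other = enumerate others
    correction : (Fin (count others) → Carrier) → Chain
    correction x e = sum (λ i → walkChain (connected (other i) r) (x i) e)
    L : Fin (k ^ℕ count others) → Chain
    L j = correction (dec ∘ finToFun j)
    residue : Chain → Fin (count others) → Fin k
    residue φ i = enc (∂ φ (other i) ⁻¹)
    -- The piece for `other l` has divergence only at its start and at `r`, so at `other i` only the
    -- piece with index `i` contributes.
    ∂-correction : ∀ x i → ∂ (correction x) (other i) ≈ x i
    ∂-correction x i = trans (∂-sum pieces (other i)) (trans (sum-only (λ l → ∂ (pieces l) (other i)) i elsewhere)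
      (trans (piece i) (trans (∙-congʳ (χ-self (other i))) (identityʳ _))))
      where
      pieces : Fin (count others) → Chain
      pieces l = walkChain (connected (other l) r) (x l)
      piece : ∀ l → ∂ (pieces l) (other i) ≈ χ (other l) (x l) (other i) ∙ ε
      piece l = trans (∂-walk (connected (other l) r) (x l) (other i)) (∙-congˡ (trans (⁻¹-cong
        (χ-other {u = r} {other i} (proj₂ (remove-⊆ (λ _ → true) r (other i) (enumerate-∈ others i))))) ε⁻¹≈ε))
      elsewhere : ∀ l → i ≢ l → ∂ (pieces l) (other i) ≈ ε
      elsewhere l i≢l = trans (piece l) (trans (identityʳ _)
        (χ-other {u = other l} {other i} (i≢l ∘ ≡.sym ∘ enumerate-injective others)))
    corrected-away : ∀ φ i → ∂ (λ e → φ e ∙ L (funToFin (residue φ)) e) (other i) ≈ ε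
    corrected-away φ i = trans (∂-∙ φ _ (other i)) (trans (∙-congˡ (trans (∂-correction _ i)
      (trans (reflexive (≡.cong dec (finToFun-funToFin (residue φ) i))) (dec-enc _)))) (inverseʳ _))
    corrected : ∀ φ → Closed (λ e → φ e ∙ L (funToFin (residue φ)) e)
    corrected φ v with r ≟ v
    ... | no r≢v with i , ≡.refl ← rank others v (remove-other {P = λ _ → true} ≡.refl r≢v) = corrected-away φ i
    -- At `r` conservation follows from that at all other vertices.
    ... | yes ≡.refl = trans (sym (sum-only (∂ ψ) r others-closed)) (sum-∂ ψ)
      where
      ψ : Chain
      ψ e = φ e ∙ L (funToFin (residue φ)) e
      others-closed : ∀ v → r ≢ v → ∂ ψ v ≈ ε
      others-closed v r≢v with i , ≡.refl ← rank others v (remove-other {P = λ _ → true} ≡.refl r≢v) =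
        corrected-away φ i

  orient-involutive : ∀ {e u v} (j : Joins e u v) x → orient j (orient j x) ≈ x
  orient-involutive (inj₁ _) x = refl
  orient-involutive (inj₂ _) x = ⁻¹-involutive x

  orient-cong : ∀ {e u v} (j : Joins e u v) {x y} → x ≈ y → orient j x ≈ orient j y
  orient-cong (inj₁ _) h = h
  orient-cong (inj₂ _) h = ⁻¹-cong h

  module _ (f : Edge → Carrier) {b : ℕ} (offset : Fin b → Carrier) where

    -- In use `offset` runs through -A, so that adding a value from A to a safe one cannot produce
    -- `f e`.
    Safe : Carrier → Edge → Set ρ
    Safe x e = ∀ i → ¬ (x ≈ f e ∙ offset i)

    safe-cong : ∀ {x y e} → x ≈ y → Safe x e → Safe y e
    safe-cong h s i eq = s i (trans h eq)

    -- Interpolates between all flows, when `S` is full, and the flows safe outside `C`, when `S` is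
    -- empty.
    partial : EdgeSet → EdgeSet → DecidableProperty ρ
    partial C S = record
      { Holds = λ φ → Closed φ × (∀ e → S e ≡ false → C e ≡ false → Safe (φ e) e)
      ; holds? = λ φ → (all? λ v → ∂ φ v ≈? ε) ×-dec
          (all? λ e → (S e Bool.≟ false) →-dec ((C e Bool.≟ false) →-dec (all? λ i → ¬? (φ e ≈? (f e ∙ offset i)))))
      ; resp = λ h (closed , safe) → (λ v → trans (sym (∂-cong h v)) (closed v)) ,
          λ e e∉S e∉C → safe-cong (h e) (safe e e∉S e∉C) }

    -- What the two kinds of closing share: `D x` carries `x` around the closed walk. The edges `e₁`
    -- and `e₂` may coincide.
    record Crossing (S S′ : EdgeSet) (D : Carrier → Chain) : Set (c ⊔ ρ) where
      field
        {e₁ e₂}         : Edge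
        {u₁ v₁ u₂ v₂}   : Vertex
        j₁              : Joins e₁ u₁ v₁
        j₂              : Joins e₂ u₂ v₂
        closed          : ∀ x → Closed (D x)
        support         : ∀ x e → S′ e ≡ false → D x e ≈ ε
        new             : ∀ e → S e ≡ false → S′ e ≡ true → e ≡ e₁ ⊎ e ≡ e₂
        value₁          : ∀ x → D x e₁ ≈ orient j₁ x
        value₂          : ∀ x → D x e₂ ≈ orient j₂ x

    -- Adding `D x` changes nothing outside `S′`, and each of the at most two new edges forbids at
    -- most `b` values of `x`.
    crossing-bound : ∀ {C S S′ D} → Crossing S S′ D →
                     (k ∸ (b + b)) *ℕ # (partial C S′) ≤ k *ℕ # (partial C S)
    crossing-bound {C} {S} {S′} {D} K = #-shift (partial C S′) (partial C S) (k ∸ (b + b)) k (D ∘ dec) choose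
      where
      open Crossing K
      module _ (φ : Chain) where
        forbidden : ∀ {e u v} → Joins e u v → Fin b → Fin k
        -- Since `orient j` is an involution, this is the solution x of φ e ∙ orient j x ≈ f e ∙
        -- offset i.
        forbidden {e} j i = enc (orient j (φ e ⁻¹ ∙ (f e ∙ offset i)))
        bad : Fin (b + b) → Fin k
        bad l = [ forbidden j₁ , forbidden j₂ ]′ (splitAt b l)
        bad₁ : ∀ i → bad (i ↑ˡ b) ≡ forbidden j₁ i
        bad₁ i = ≡.cong [ forbidden j₁ , forbidden j₂ ]′ (splitAt-↑ˡ b i b)
        bad₂ : ∀ i → bad (b ↑ʳ i) ≡ forbidden j₂ i
        bad₂ i = ≡.cong [ forbidden j₁ , forbidden j₂ ]′ (splitAt-↑ʳ b b i)
        hits : ∀ {e u v} (j : Joins e u v) t → D (dec t) e ≈ orient j (dec t) → ∀ i →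
               φ e ∙ D (dec t) e ≈ f e ∙ offset i → t ≡ forbidden j i
        hits {e} j t value i eq = ≡.trans (≡.sym (enc-dec t)) (enc-cong (begin
          dec t                                    ≈⟨ orient-involutive j (dec t) ⟨
          orient j (orient j (dec t))              ≈⟨ orient-cong j (begin
            orient j (dec t)                         ≈⟨ value ⟨
            D (dec t) e                              ≈⟨ identityˡ _ ⟨
            ε ∙ D (dec t) e                          ≈⟨ ∙-congʳ (inverseˡ (φ e)) ⟨
            (φ e ⁻¹ ∙ φ e) ∙ D (dec t) e             ≈⟨ assoc _ _ _ ⟩
            φ e ⁻¹ ∙ (φ e ∙ D (dec t) e)             ≈⟨ ∙-congˡ eq ⟩
            φ e ⁻¹ ∙ (f e ∙ offset i)                ∎) ⟩
          orient j (φ e ⁻¹ ∙ (f e ∙ offset i))     ∎))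
          where open SetoidReasoning setoid
      choose : ∀ φ → DecidableProperty.Holds (partial C S′) φ →
               ∃[ j ] (Injective _≡_ _≡_ j × (∀ (i : Fin (k ∸ (b + b))) →
                 DecidableProperty.Holds (partial C S) (λ e → φ e ∙ D (dec (j i)) e)))
      choose φ (φ-closed , φ-safe) with j , j-injective , j-avoids ← avoiding (bad φ) =
        j , j-injective , λ i → closed-∙ φ-closed (closed (dec (j i))) , safe i
        where
        safe : ∀ i e → S e ≡ false → C e ≡ false → Safe (φ e ∙ D (dec (j i)) e) e
        safe i e e∉S e∉C with bool-cases (S′ e)
        ... | inj₂ e∉S′ = safe-cong (sym (trans (∙-congˡ (support _ e e∉S′)) (identityʳ _))) (φ-safe e e∉S′ e∉C)
        ... | inj₁ e∈S′ with new e e∉S e∈S′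
        ...   | inj₁ ≡.refl = λ l eq →
          j-avoids i (l ↑ˡ b) (≡.trans (hits φ j₁ (j i) (value₁ _) l eq) (≡.sym (bad₁ φ l)))
        ...   | inj₂ ≡.refl = λ l eq →
          j-avoids i (b ↑ʳ l) (≡.trans (hits φ j₂ (j i) (value₂ _) l eq) (≡.sym (bad₂ φ l)))

    crossing₁ : ∀ {S e u v} → S e ≡ false → Joins e u v → Walk S u v → ∃[ D ] Crossing S (insert e S) D
    crossing₁ {S} {e} {u} {v} e∉S j w = D , record
      -- The single new edge fills both slots, so that one bound serves both kinds of closing.
      { j₁ = j ; j₂ = j ; closed = D-closed ; support = D-support ; new = new
      ; value₁ = value ; value₂ = value }
      where
      D : Carrier → Chain
      D x g = χ e (orient j x) g ∙ walkChain (reverse w) x g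
      D-closed : ∀ x → Closed (D x)
      D-closed x y = trans (∂-∙ (χ e (orient j x)) _ y)
        (trans (∙-cong (trans (∂-χ e _ y) (arc-orient j x y)) (∂-walk (reverse w) x y))
        (trans (arc-compose u v u x y) (arc-loop u y x)))
      D-support : ∀ x g → insert e S g ≡ false → D x g ≈ ε
      D-support x g g∉ = trans (∙-cong (χ-other {u = e} {g} λ { ≡.refl → true≢false (insert-self e S) g∉ })
        (walkChain-support (reverse w) x g (insert-∉ e S g∉))) (identityˡ ε)
      new : ∀ g → S g ≡ false → insert e S g ≡ true → g ≡ e ⊎ g ≡ e
      new g g∉S g∈ with ∨-elim (S g) g∈
      ... | inj₁ g∈S = contradiction g∉S (true≢false g∈S)
      ... | inj₂ eq  = inj₁ (≡.sym (==⇒≡ eq))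
      value : ∀ x → D x e ≈ orient j x
      value x = trans (∙-cong (χ-self e) (walkChain-support (reverse w) x e e∉S)) (identityʳ _)

    crossing₂ : ∀ {S e₁ e₂ u₁ v₁ u₂ v₂} → S e₁ ≡ false → S e₂ ≡ false → e₁ ≢ e₂ →
                Joins e₁ u₁ v₁ → Joins e₂ u₂ v₂ → Walk S u₁ u₂ → Walk S v₁ v₂ →
                ∃[ D ] Crossing S (insert e₂ (insert e₁ S)) D
    crossing₂ {S} {e₁} {e₂} {u₁} {v₁} {u₂} {v₂} e₁∉S e₂∉S e₁≢e₂ j₁ j₂ p q = D , record
      { j₁ = j₁ ; j₂ = joins-sym j₂ ; closed = D-closed ; support = D-support ; new = new
      ; value₁ = value₁ ; value₂ = value₂ }
      where
      j₂′ : Joins e₂ v₂ u₂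
      j₂′ = joins-sym j₂
      -- The closed walk is `e₁` from `u₁` to `v₁`, then `q` to `v₂`, then `e₂` to `u₂`, then `p`
      -- reversed back to `u₁`. `D₁` and `D₂` are its two halves.
      D₁ D₂ D : Carrier → Chain
      D₁ x g = χ e₁ (orient j₁ x) g ∙ walkChain q x g
      D₂ x g = χ e₂ (orient j₂′ x) g ∙ walkChain (reverse p) x g
      D x g = D₁ x g ∙ D₂ x g
      half : ∀ {e u v w} (j : Joins e u v) (z : Walk S v w) x y →
             ∂ (λ g → χ e (orient j x) g ∙ walkChain z x g) y ≈ arc u w x y
      half {e} {u} {v} {w} j z x y = trans (∂-∙ (χ e (orient j x)) _ y)
        (trans (∙-cong (trans (∂-χ e _ y) (arc-orient j x y)) (∂-walk z x y)) (arc-compose u v w x y))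
      D-closed : ∀ x → Closed (D x)
      D-closed x y = trans (∂-∙ (D₁ x) (D₂ x) y)
        (trans (∙-cong (half j₁ q x y) (half j₂′ (reverse p) x y))
        (trans (arc-compose u₁ v₂ u₁ x y) (arc-loop u₁ y x)))
      half-ε : ∀ {e u v w} (j : Joins e u v) (z : Walk S v w) x g → e ≢ g → S g ≡ false →
               χ e (orient j x) g ∙ walkChain z x g ≈ ε
      half-ε {e} j z x g e≢g g∉S =
        trans (∙-cong (χ-other {u = e} {g} e≢g) (walkChain-support z x g g∉S)) (identityˡ ε)
      half-value : ∀ {e u v w} (j : Joins e u v) (z : Walk S v w) x → S e ≡ false →
                   χ e (orient j x) e ∙ walkChain z x e ≈ orient j x
      half-value {e} j z x e∉S = trans (∙-cong (χ-self e) (walkChain-support z x e e∉S)) (identityʳ _)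
      D-support : ∀ x g → insert e₂ (insert e₁ S) g ≡ false → D x g ≈ ε
      D-support x g g∉ = trans (∙-cong (half-ε j₁ q x g e₁≢g g∉S) (half-ε j₂′ (reverse p) x g e₂≢g g∉S))
                               (identityˡ ε)
        where
        g∉S₁ : insert e₁ S g ≡ false
        g∉S₁ = insert-∉ e₂ (insert e₁ S) g∉
        g∉S : S g ≡ false
        g∉S = insert-∉ e₁ S g∉S₁
        e₁≢g : e₁ ≢ g
        e₁≢g ≡.refl = true≢false (insert-self e₁ S) g∉S₁
        e₂≢g : e₂ ≢ g
        e₂≢g ≡.refl = true≢false (insert-self e₂ (insert e₁ S)) g∉
      new : ∀ g → S g ≡ false → insert e₂ (insert e₁ S) g ≡ true → g ≡ e₁ ⊎ g ≡ e₂
      new g g∉S g∈ with ∨-elim (insert e₁ S g) g∈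
      ... | inj₂ eq = inj₂ (≡.sym (==⇒≡ eq))
      ... | inj₁ g∈′ with ∨-elim (S g) g∈′
      ...   | inj₁ g∈S = contradiction g∉S (true≢false g∈S)
      ...   | inj₂ eq  = inj₁ (≡.sym (==⇒≡ eq))
      value₁ : ∀ x → D x e₁ ≈ orient j₁ x
      value₁ x = trans
        (∙-cong (half-value j₁ q x e₁∉S) (half-ε j₂′ (reverse p) x e₁ (e₁≢e₂ ∘ ≡.sym) e₁∉S)) (identityʳ _)
      value₂ : ∀ x → D x e₂ ≈ orient j₂′ x
      value₂ x = trans (∙-cong (half-ε j₁ q x e₂ e₁≢e₂ e₂∉S) (half-value j₂′ (reverse p) x e₂∉S)) (identityˡ _)

    private
      chain-bounds : ∀ d k s {x y z} → d ^ℕ s *ℕ x ≤ k ^ℕ s *ℕ y → d *ℕ y ≤ k *ℕ z →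
                     d ^ℕ suc s *ℕ x ≤ k ^ℕ suc s *ℕ z
      chain-bounds d k s {x} {y} {z} h₁ h₂ = begin
        (d *ℕ d ^ℕ s) *ℕ x    ≡⟨ *-assoc d (d ^ℕ s) x ⟩
        d *ℕ (d ^ℕ s *ℕ x)    ≤⟨ *-monoʳ-≤ d h₁ ⟩
        d *ℕ (k ^ℕ s *ℕ y)    ≡⟨ *-swap d (k ^ℕ s) y ⟩
        k ^ℕ s *ℕ (d *ℕ y)    ≤⟨ *-monoʳ-≤ (k ^ℕ s) h₂ ⟩
        k ^ℕ s *ℕ (k *ℕ z)    ≡⟨ *-swap (k ^ℕ s) k z ⟩
        k *ℕ (k ^ℕ s *ℕ z)    ≡⟨ *-assoc k (k ^ℕ s) z ⟨
        (k *ℕ k ^ℕ s) *ℕ z    ∎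
        where
        open ≤-Reasoning

    -- Induction back from the full set: each closing costs one `crossing-bound`, while seeding is
    -- free because `partial` exempts the edges of `C` anyway.
    steps-bound : ∀ {C S s} → Steps C S s →
                  (k ∸ (b + b)) ^ℕ s *ℕ # flows ≤ k ^ℕ s *ℕ # (partial C S)
    steps-bound {C} {S} (done full) = *-monoʳ-≤ 1 (#-mono flows (partial C S)
      λ φ closed → closed , λ e e∉S → contradiction e∉S (true≢false (full e)))
    steps-bound {C} {S} {s} (seed {S′ = S′} h steps) = ≤-trans (steps-bound steps)
      (*-monoʳ-≤ (k ^ℕ s) (#-mono (partial C S′) (partial C S) λ φ (closed , safe) →
        closed , λ e e∉S e∉C → safe e (outside e e∉S e∉C) e∉C))
      where
      outside : ∀ e → S e ≡ false → C e ≡ false → S′ e ≡ false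
      outside e e∉S e∉C with bool-cases (S′ e)
      ... | inj₂ p = p
      ... | inj₁ p with h e p
      ...   | inj₁ e∈S = contradiction e∉S (true≢false e∈S)
      ...   | inj₂ e∈C = contradiction e∉C (true≢false e∈C)
    steps-bound (close₁ {s = s} e∉S j w steps) =
      chain-bounds (k ∸ (b + b)) k s (steps-bound steps) (crossing-bound (proj₂ (crossing₁ e∉S j w)))
    steps-bound (close₂ {s = s} e₁∉S e₂∉S e₁≢e₂ j₁ j₂ p q steps) =
      chain-bounds (k ∸ (b + b)) k s (steps-bound steps)
        (crossing-bound (proj₂ (crossing₂ e₁∉S e₂∉S e₁≢e₂ j₁ j₂ p q)))

    module _ (a : Carrier) (a≉ε : ¬ (a ≈ ε))
             (offsets : ∀ y → y ≈ ε ⊎ y ≈ a ⊎ y ≈ a ⁻¹ → ∃[ i ] offset i ≈ y ⁻¹) where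
      open Prescribe Γ G a

      avoidingFlows : DecidableProperty ρ
      avoidingFlows = record
        { Holds = λ φ → IsFlow φ × (∀ e → ¬ (φ e ≈ f e))
        ; holds? = λ φ → map′ ∂⇒flow flow⇒∂ (all? λ v → ∂ φ v ≈? ε) ×-dec (all? λ e → ¬? (φ e ≈? f e))
        ; resp = λ h (flow , avoid) →
            ∂⇒flow (λ v → trans (sym (∂-cong h v)) (flow⇒∂ flow v)) , λ e eq → avoid e (trans (h e) eq) }

      selection : ∀ {C : EdgeSet} → Fin (2 ^ℕ count C) → EdgeSet
      selection {C} t e with bool-cases (C e)
      ... | inj₁ e∈C = does (finToFun {2} {count C} t (proj₁ (rank C e e∈C)) ≟ suc zero)
      ... | inj₂ _   = false

      select : ∀ (C X : EdgeSet) → Fin (2 ^ℕ count C)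
      select C X = funToFin (λ i → if X (enumerate C i) then suc zero else zero)

      selection-select : ∀ C X e → C e ≡ true → selection {C} (select C X) e ≡ X e
      selection-select C X e e∈C with bool-cases (C e)
      ... | inj₂ e∉C = contradiction e∉C (true≢false e∈C)
      ... | inj₁ e∈C with i , ≡.refl ← rank C e e∈C
        rewrite finToFun-funToFin {count C} {2} (λ i → if X (enumerate C i) then suc zero else zero) i
        with X (enumerate C i)
      ...   | true  = ≡.refl
      ...   | false = ≡.refl

      -- Outside `C`, a sum equal to `f e` would put `φ e` at an excluded offset. On `C` the added
      -- value is nonzero exactly where `φ` agrees with `f`, so old agreements vanish and no new
      -- ones arise.
      partial-bound : ∀ C → (∀ u v → Walk (not ∘ C) u v) →
                      # (partial C (λ _ → false)) ≤ 2 ^ℕ count C *ℕ # avoidingFlows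
      partial-bound C connected = ≤-trans (≤-reflexive (≡.sym (*-identityˡ _)))
        (#-shift (partial C (λ _ → false)) avoidingFlows 1 _ (λ t → Prescribed.chain (fix t))
          λ φ (closed , safe) → (λ _ → select C (hit φ)) , fin1-injective _ ,
            λ _ → ∂⇒flow (closed-∙ closed (Prescribed.closed (fix (select C (hit φ))))) , avoids φ safe)
        where
        -- Chosen from the subset alone and not from `φ`, so that the subset and the sum give `φ`
        -- back.
        fix : (t : Fin (2 ^ℕ count C)) → Prescribed C (selection {C} t)
        fix t = prescribe C connected (selection {C} t)
        hit : Chain → EdgeSet
        hit φ e = does (φ e ≈? f e)
        avoids : ∀ φ → (∀ e → false ≡ false → C e ≡ false → Safe (φ e) e) →
                 ∀ e → ¬ (φ e ∙ Prescribed.chain (fix (select C (hit φ))) e ≈ f e)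
        avoids φ safe e eq with bool-cases (C e)
        ... | inj₂ e∉C with i , offset-i ← offsets _ (Prescribed.small (fix (select C (hit φ))) e) =
          safe e ≡.refl e∉C i (trans (sym (//-rightDividesʳ _ (φ e))) (∙-cong eq (sym offset-i)))
        ... | inj₁ e∈C with φ e ≈? f e in hit-e
        ...   | yes φ≈f = [ a≉ε ∘ vanishes , a⁻¹≉ε ∘ vanishes ]′
          (Prescribed.shifted (fix (select C (hit φ))) e e∈C
            (≡.trans (selection-select C (hit φ) e e∈C) (≡.cong does hit-e)))
          where
          vanishes : ∀ {y} → Prescribed.chain (fix (select C (hit φ))) e ≈ y → y ≈ ε
          vanishes chain≈y = trans (sym chain≈y)
            (∙-cancelˡ (φ e) _ _ (trans eq (trans (sym φ≈f) (sym (identityʳ _)))))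
          a⁻¹≉ε : ¬ (a ⁻¹ ≈ ε)
          a⁻¹≉ε a⁻¹≈ε = a≉ε (trans (sym (⁻¹-involutive a)) (trans (⁻¹-cong a⁻¹≈ε) ε⁻¹≈ε))
        avoids φ safe e eq | inj₁ e∈C | no φ≉f = φ≉f (trans (sym (identityʳ _))
          (trans (∙-congˡ (sym (Prescribed.still (fix (select C (hit φ))) e e∈C
                               (≡.trans (selection-select C (hit φ) e e∈C) (≡.cong does hit-e))))) eq))

-- Finite abelian groups

-- An element and its partner are removed together; what is left is still closed under `τ`.
fixed-point-free⇒even : ∀ {n} fuel (τ : Fin n → Fin n) (P : BoolSubset n) → (∀ x → τ (τ x) ≡ x) →
  (∀ x → P x ≡ true → P (τ x) ≡ true) → (∀ x → P x ≡ true → τ x ≢ x) → count P ≤ fuel → 2 ∣ count P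
fixed-point-free⇒even fuel τ P inv closed free fuel≥ with search P
... | inj₂ none rewrite count-none P none = divides 0 ≡.refl
fixed-point-free⇒even zero τ P inv closed free fuel≥ | inj₁ (x , p)
  rewrite count-remove P x p with () ← fuel≥
fixed-point-free⇒even (suc fuel) τ P inv closed free fuel≥ | inj₁ (x , p) =
  ≡.subst (2 ∣_) (≡.sym two-fewer) (∣m∣n⇒∣m+n ∣-refl (fixed-point-free⇒even fuel τ P′ inv closed′
    (λ y → free y ∘ P′⊆P y) (ℕ.≤-pred (ℕ.≤-trans (ℕ.n≤1+n _) (ℕ.≤-trans (ℕ.≤-reflexive (≡.sym two-fewer)) fuel≥)))))
  where
  P′ : BoolSubset _
  P′ = remove (τ x) (remove x P)
  τx∈ : remove x P (τ x) ≡ true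
  τx∈ = remove-other {P = P} (closed x p) (free x p ∘ ≡.sym)
  two-fewer : count P ≡ 2 + count P′
  two-fewer = ≡.trans (count-remove P x p) (≡.cong suc (count-remove (remove x P) (τ x) τx∈))
  P′⊆P : ∀ y → P′ y ≡ true → P y ≡ true
  P′⊆P y q = proj₁ (remove-⊆ P x y (proj₁ (remove-⊆ (remove x P) (τ x) y q)))
  closed′ : ∀ y → P′ y ≡ true → P′ (τ y) ≡ true
  closed′ y q with q′ , τx≢y ← remove-⊆ (remove x P) (τ x) y q with q″ , x≢y ← remove-⊆ P x y q′ =
    remove-other {P = remove x P} (remove-other {P = P} (closed y q″)
        (λ x≡τy → τx≢y (≡.trans (≡.cong τ x≡τy) (inv y))))
      (λ τx≡τy → x≢y (≡.trans (≡.sym (inv x)) (≡.trans (≡.cong τ τx≡τy) (inv y))))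

module _ (Γ : AbelianGroup c ρ) {k : ℕ} (finite : HasCardinality (AbelianGroup.setoid Γ) k) where
  open AbelianGroup Γ
  open AbelianGroupProperties Γ using (⁻¹-involutive; ε⁻¹≈ε)
  open Inverse finite using () renaming
    (to to enc; from to dec; to-cong to enc-cong; strictlyInverseˡ to enc-dec; strictlyInverseʳ to dec-enc)

  private
    dec-≢ : ∀ {i} → i ≢ enc ε → ¬ (dec i ≈ ε)
    dec-≢ i≢ eq = i≢ (≡.trans (≡.sym (enc-dec _)) (enc-cong eq))

  nontrivial : 2 ≤ k → ∃[ a ] ¬ (a ≈ ε)
  nontrivial 2≤k with inject≤ zero 2≤k ≟ enc ε | inject≤ (suc zero) 2≤k ≟ enc ε
  ... | no 0≢ | _     = _ , dec-≢ 0≢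
  ... | _     | no 1≢ = _ , dec-≢ 1≢
  ... | yes p | yes q with () ← inject≤-injective 2≤k 2≤k _ _ (≡.trans p (≡.sym q))

  -- Otherwise inversion would pair off the nonzero elements without a fixed point, making k - 1
  -- even.
  involution : 2 ∣ k → ∃[ a ] (¬ (a ≈ ε) × a ≈ a ⁻¹)
  involution 2∣k with any? (λ x → ¬? (x ≟ enc ε) ×-dec (enc (dec x ⁻¹) ≟ x))
  ... | yes (x , x≢ , fixed) = dec x , dec-≢ x≢ ,
    trans (reflexive (≡.cong dec (≡.sym fixed))) (dec-enc _)
  ... | no none = contradiction (∣1⇒≡1 (∣m+n∣m⇒∣n 2∣others+1 even)) λ ()
    where
    τ : Fin k → Fin k
    τ x = enc (dec x ⁻¹)
    others : BoolSubset k
    others = remove (enc ε) (λ _ → true)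
    inv : ∀ x → τ (τ x) ≡ x
    inv x = ≡.trans (enc-cong (trans (⁻¹-cong (dec-enc _)) (⁻¹-involutive _))) (enc-dec x)
    τ-ε : τ (enc ε) ≡ enc ε
    τ-ε = enc-cong (trans (⁻¹-cong (dec-enc ε)) ε⁻¹≈ε)
    even : 2 ∣ count others
    even = fixed-point-free⇒even _ τ others inv
      (λ x p → remove-other {P = λ _ → true} ≡.refl λ eq →
        proj₂ (remove-⊆ (λ _ → true) (enc ε) x p) (≡.trans (≡.sym τ-ε) (≡.trans (≡.cong τ eq) (inv x))))
      (λ x p fixed → none (x , (λ eq → proj₂ (remove-⊆ (λ _ → true) (enc ε) x p) (≡.sym eq)) , fixed))
      ℕ.≤-refl
    2∣others+1 : 2 ∣ count others + 1
    2∣others+1 = ≡.subst (2 ∣_) (≡.trans (≡.sym (count-full {k} (λ _ → true) λ _ → ≡.refl))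
      (≡.trans (count-remove (λ _ → true) (enc ε) ≡.refl) (ℕ.+-comm 1 _))) 2∣k

  -- The bound in natural numbers

  module _ (G : OrientedGraph) (conn : OrientedGraph.EdgeConnected G 3)
           (f : OrientedGraph.Edge G → Carrier) where
    open OrientedGraph G
    open Walks G
    open Closing G
    open FlowCounting G Γ finite
    open ChainCounting Γ finite #E using (#)

    -- Let `cyc` be |E| - |V| + 1. There are at least k ^ cyc flows, hence at least d ^ s * k ^ (cyc
    -- - s) ≥ d ^ cyc flows safe outside `C`, and at most 2 ^ cyc of these share a sum. Lowering the
    -- exponent of `d` from `cyc` to `#E ∸ #V` only weakens the bound, as d ≥ 1.
    lower-bound : ∀ {b} (offset : Fin b → Carrier) a (a≉ε : ¬ (a ≈ ε)) offsets → 1 ≤ k ∸ (b + b) →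
      (k ∸ (b + b)) ^ℕ (#E ∸ #V) ≤ 2 ^ℕ suc (#E ∸ #V) *ℕ # (avoidingFlows f offset a a≉ε offsets)
    lower-bound {b} offset a a≉ε offsets 1≤d = from (decomposition conn root)
      where
      root : Vertex
      root = inject≤ {2} zero (proj₁ conn)
      d = k ∸ (b + b)
      N = # (avoidingFlows f offset a a≉ε offsets)
      others = count (remove root (λ _ → true))
      #V≡ : #V ≡ suc others
      #V≡ = ≡.trans (≡.sym (count-full {#V} (λ _ → true) λ _ → ≡.refl)) (count-remove (λ _ → true) root ≡.refl)
      cyc = #E ∸ others
      instance
        d≢0 : NonZero d
        d≢0 = >-nonZero 1≤d
        k≢0 : NonZero k
        k≢0 = >-nonZero (ℕ.≤-trans 1≤d (ℕ.m∸n≤m k (b + b)))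
      below : ∀ {s} → s + #V ≤ suc #E → s ≤ cyc
      below {s} h = ℕ.m+n≤o⇒m≤o∸n s (ℕ.≤-pred (ℕ.≤-trans (ℕ.≤-reflexive
        (≡.trans (≡.sym (ℕ.+-suc s others)) (≡.cong (λ z → s + z) (≡.sym #V≡)))) h))
      from : Decomposition conn → d ^ℕ (#E ∸ #V) ≤ 2 ^ℕ suc (#E ∸ #V) *ℕ N
      from D = begin
        d ^ℕ (#E ∸ #V)             ≤⟨ ℕ.^-monoʳ-≤ d (ℕ.∸-monoʳ-≤ #E others≤) ⟩
        d ^ℕ cyc                   ≡⟨ ≡.cong (d ^ℕ_) (ℕ.m+[n∸m]≡n s≤) ⟨
        d ^ℕ (s + t)              ≡⟨ ℕ.^-distribˡ-+-* d s t ⟩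
        d ^ℕ s *ℕ d ^ℕ t           ≤⟨ ℕ.*-monoʳ-≤ (d ^ℕ s) (ℕ.^-monoˡ-≤ t (ℕ.m∸n≤m k (b + b))) ⟩
        -- Multiplied by k ^ s, the left side becomes d ^ s * k ^ cyc, to which `flows≥` and
        -- `steps-bound` apply without division.
        d ^ℕ s *ℕ k ^ℕ t           ≤⟨ ℕ.*-cancelˡ-≤ (k ^ℕ s) {{ℕ.m^n≢0 k s}} (begin
          k ^ℕ s *ℕ (d ^ℕ s *ℕ k ^ℕ t) ≡⟨ *-swap (k ^ℕ s) (d ^ℕ s) (k ^ℕ t) ⟩
          d ^ℕ s *ℕ (k ^ℕ s *ℕ k ^ℕ t)
            ≡⟨ ≡.cong (d ^ℕ s *ℕ_) (≡.trans (≡.sym (ℕ.^-distribˡ-+-* k s t)) (≡.cong (k ^ℕ_) (ℕ.m+[n∸m]≡n s≤))) ⟩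
          d ^ℕ s *ℕ k ^ℕ cyc           ≤⟨ ℕ.*-monoʳ-≤ (d ^ℕ s) flows≥ ⟩
          d ^ℕ s *ℕ # flows            ≤⟨ steps-bound f offset steps ⟩
          k ^ℕ s *ℕ # (partial f offset C (λ _ → false)) ∎) ⟩
        # (partial f offset C (λ _ → false)) ≤⟨ partial-bound f offset a a≉ε offsets C connected ⟩
        2 ^ℕ count C *ℕ N          ≤⟨ ℕ.*-monoˡ-≤ N (ℕ.^-monoʳ-≤ 2 (ℕ.≤-trans (below C-bound) cyc≤)) ⟩
        2 ^ℕ suc (#E ∸ #V) *ℕ N    ∎
        where
        open ℕ.≤-Reasoning
        open Decomposition D
        s≤ : s ≤ cyc
        s≤ = below s-bound
        t = cyc ∸ s
        others≤ : others ≤ #V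
        others≤ = ℕ.≤-trans (ℕ.n≤1+n others) (ℕ.≤-reflexive (≡.sym #V≡))
        cyc≤ : cyc ≤ suc (#E ∸ #V)
        cyc≤ = ℕ.≤-trans (ℕ.m≤n+m∸n cyc 1) (s≤s (ℕ.≤-reflexive (≡.trans (ℕ.∸-+-assoc #E others 1)
          (≡.cong (#E ∸_) (≡.trans (ℕ.+-comm others 1) (≡.sym #V≡))))))
        others≤#E : others ≤ #E
        others≤#E = ℕ.≤-pred (ℕ.≤-trans (ℕ.≤-reflexive (≡.sym #V≡)) (ℕ.≤-trans (ℕ.m≤n+m #V s) s-bound))
        flows≥ : k ^ℕ cyc ≤ # flows
        flows≥ = ℕ.*-cancelˡ-≤ (k ^ℕ others) {{ℕ.m^n≢0 k others}} (ℕ.≤-trans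
          (ℕ.≤-reflexive (≡.trans (≡.sym (ℕ.^-distribˡ-+-* k others cyc)) (≡.cong (k ^ℕ_) (ℕ.m+[n∸m]≡n others≤#E))))
          (flows-lower root λ u v → walk-mono (λ _ _ → ≡.refl) (connected u v)))

    abstract
      counted-flows : ∀ {b} (offset : Fin b → Carrier) a → ¬ (a ≈ ε) →
        (∀ y → y ≈ ε ⊎ y ≈ a ⊎ y ≈ a ⁻¹ → ∃[ i ] offset i ≈ y ⁻¹) → 1 ≤ k ∸ (b + b) →
        ∃[ N ] (HasCardinality (Flows.flowsAvoiding G Γ f) N
                × (k ∸ (b + b)) ^ℕ (#E ∸ #V) ≤ 2 ^ℕ suc (#E ∸ #V) *ℕ N)
      counted-flows offset a a≉ε offsets 1≤d =
        # P , cardinality P , lower-bound offset a a≉ε offsets 1≤d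
        where
        open ChainCounting Γ finite #E using (DecidableProperty; cardinality)
        P : DecidableProperty ρ
        P = avoidingFlows f offset a a≉ε offsets

      even-count : 2 ∣ k → 6 ≤ k →
        ∃[ N ] (HasCardinality (Flows.flowsAvoiding G Γ f) N
                × (k ∸ 4) ^ℕ (#E ∸ #V) ≤ 2 ^ℕ suc (#E ∸ #V) *ℕ N)
      even-count 2∣k 6≤k with a , a≉ε , a≈a⁻¹ ← involution 2∣k =
        counted-flows offset a a≉ε offsets (≤-trans (s≤s z≤n) (ℕ.∸-monoˡ-≤ 4 6≤k))
        where
        -- As `a` is its own inverse, two offsets cover -A.
        offset : Fin 2 → Carrier
        offset zero    = ε
        offset (suc _) = a
        offsets : ∀ y → y ≈ ε ⊎ y ≈ a ⊎ y ≈ a ⁻¹ → ∃[ i ] offset i ≈ y ⁻¹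
        offsets y (inj₁ y≈ε)          = zero , trans (sym ε⁻¹≈ε) (⁻¹-cong (sym y≈ε))
        offsets y (inj₂ (inj₁ y≈a))   = suc zero , trans a≈a⁻¹ (⁻¹-cong (sym y≈a))
        offsets y (inj₂ (inj₂ y≈a⁻¹)) = suc zero , trans (sym (⁻¹-involutive a)) (⁻¹-cong (sym y≈a⁻¹))

      odd-count : 2 ∤ k → 6 ≤ k →
        ∃[ N ] (HasCardinality (Flows.flowsAvoiding G Γ f) N
                × (k ∸ 6) ^ℕ (#E ∸ #V) ≤ 2 ^ℕ suc (#E ∸ #V) *ℕ N)
      odd-count 2∤k 6≤k with a , a≉ε ← nontrivial (≤-trans (s≤s (s≤s z≤n)) 6≤k) =
        counted-flows offset a a≉ε offsets
          -- 6 is even, so an odd `k` here is at least 7 and k - 6 is positive.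
          (ℕ.m<n⇒0<n∸m (ℕ.≤∧≢⇒< 6≤k λ { ≡.refl → 2∤k (divides 3 ≡.refl) }))
        where
        offset : Fin 3 → Carrier
        offset zero          = ε
        offset (suc zero)    = a
        offset (suc (suc _)) = a ⁻¹
        offsets : ∀ y → y ≈ ε ⊎ y ≈ a ⊎ y ≈ a ⁻¹ → ∃[ i ] offset i ≈ y ⁻¹
        offsets y (inj₁ y≈ε)          = zero , trans (sym ε⁻¹≈ε) (⁻¹-cong (sym y≈ε))
        offsets y (inj₂ (inj₁ y≈a))   = suc (suc zero) , ⁻¹-cong (sym y≈a)
        offsets y (inj₂ (inj₂ y≈a⁻¹)) = suc zero , trans (sym (⁻¹-involutive a)) (⁻¹-cong (sym y≈a⁻¹))

-- The rational form of the bound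

ι : ℕ → ℚ
ι n = + n / 1

toℚᵘ-/ : ∀ p n → toℚᵘ (p / suc n) ℚᵘ.≃ mkℚᵘ p n
toℚᵘ-/ p n = ℚ.toℚᵘ-fromℚᵘ (mkℚᵘ p n)

ι-* : ∀ m n → ι (m *ℕ n) ≡ ι m * ι n
ι-* m n = ℚ.toℚᵘ-injective (ℚᵘ.≃-trans (toℚᵘ-/ (+ (m *ℕ n)) 0) (ℚᵘ.≃-trans
  (*≡* (≡.cong (ℤ._* + 1) (ℤ.pos-* m n)))
  (ℚᵘ.≃-sym (ℚᵘ.≃-trans (ℚ.toℚᵘ-homo-* (ι m) (ι n)) (ℚᵘ.*-cong (toℚᵘ-/ (+ m) 0) (toℚᵘ-/ (+ n) 0))))))

ι-mono : ∀ {m n} → m ≤ n → ι m ≤ℚ ι n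
ι-mono {m} {n} m≤n = ℚ.toℚᵘ-cancel-≤ (ℚᵘ.≤-respˡ-≃ (ℚᵘ.≃-sym (toℚᵘ-/ (+ m) 0))
  (ℚᵘ.≤-respʳ-≃ (ℚᵘ.≃-sym (toℚᵘ-/ (+ n) 0)) (*≤* (ℤ.*-monoʳ-≤-nonNeg (+ 1) (ℤ.+≤+ m≤n)))))

half-* : ∀ d → (+ d / 2) * ι 2 ≡ ι d
half-* d = ℚ.toℚᵘ-injective (ℚᵘ.≃-trans (ℚᵘ.≃-trans (ℚ.toℚᵘ-homo-* (+ d / 2) (ι 2))
  (ℚᵘ.*-cong (toℚᵘ-/ (+ d) 1) (toℚᵘ-/ (+ 2) 0))) (ℚᵘ.≃-trans
  (*≡* (ℤ.*-identityʳ _)) (ℚᵘ.≃-sym (toℚᵘ-/ (+ d) 0))))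

half^-* : ∀ d ℓ → (+ d / 2) ^ ℓ * ι (2 ^ℕ ℓ) ≡ ι (d ^ℕ ℓ)
half^-* d zero    = ≡.refl
half^-* d (suc ℓ) = begin
  (x * x ^ ℓ) * ι (2 *ℕ 2 ^ℕ ℓ)      ≡⟨ ≡.cong (x * x ^ ℓ *_) (ι-* 2 (2 ^ℕ ℓ)) ⟩
  (x * x ^ ℓ) * (ι 2 * ι (2 ^ℕ ℓ))   ≡⟨ ℚ-interchange x (x ^ ℓ) (ι 2) (ι (2 ^ℕ ℓ)) ⟩
  (x * ι 2) * (x ^ ℓ * ι (2 ^ℕ ℓ))   ≡⟨ ≡.cong₂ _*_ (half-* d) (half^-* d ℓ) ⟩
  ι d * ι (d ^ℕ ℓ)                   ≡⟨ ι-* d (d ^ℕ ℓ) ⟨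
  ι (d *ℕ d ^ℕ ℓ)                    ∎
  where
  x = + d / 2
  open ≡.≡-Reasoning

-- Both sides are multiplied by 2 ^ (ℓ + 1): `½` absorbs one factor 2 and each of the ℓ halved
-- factors another. As `m ≤ k`, the integer difference is the truncated one.
rational-bound : ∀ {k m} ℓ N → m ≤ k → (k ∸ m) ^ℕ ℓ ≤ 2 ^ℕ suc ℓ *ℕ N →
                 + N / 1 ≥ ½ * ((+ k ℤ.- + m) / 2) ^ ℓ
rational-bound {k} {m} ℓ N m≤k h rewrite ℤ.m-n≡m⊖n k m | ℤ.⊖-≥ m≤k =
  ℚ.*-cancelʳ-≤-pos (ι (2 ^ℕ suc ℓ)) {{ι-pos}} (begin
  ½ * x ^ ℓ * ι (2 *ℕ 2 ^ℕ ℓ)       ≡⟨ ≡.cong (½ * x ^ ℓ *_) (ι-* 2 (2 ^ℕ ℓ)) ⟩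
  ½ * x ^ ℓ * (ι 2 * ι (2 ^ℕ ℓ))    ≡⟨ ℚ-interchange ½ (x ^ ℓ) (ι 2) (ι (2 ^ℕ ℓ)) ⟩
  ½ * ι 2 * (x ^ ℓ * ι (2 ^ℕ ℓ))    ≡⟨ ≡.cong₂ _*_ (half-* 1) (half^-* (k ∸ m) ℓ) ⟩
  ι 1 * ι ((k ∸ m) ^ℕ ℓ)            ≡⟨ ℚ.*-identityˡ _ ⟩
  ι ((k ∸ m) ^ℕ ℓ)                  ≤⟨ ι-mono h ⟩
  ι (2 ^ℕ suc ℓ *ℕ N)               ≡⟨ ι-* (2 ^ℕ suc ℓ) N ⟩
  ι (2 ^ℕ suc ℓ) * ι N              ≡⟨ ℚ.*-comm (ι (2 ^ℕ suc ℓ)) (ι N) ⟩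
  ι N * ι (2 ^ℕ suc ℓ)              ∎)
  where
  x = + (k ∸ m) / 2
  open ℚ.≤-Reasoning
  ι-pos : Positive (ι (2 ^ℕ suc ℓ))
  ι-pos = ℚ.normalize-pos (2 ^ℕ suc ℓ) 1 {{_}} {{ℕ.m^n≢0 2 (suc ℓ)}}

theorem1p9 : ∀ {c r : Level}
    (G : OrientedGraph) → OrientedGraph.EdgeConnected G 3 →
    let ℓ = OrientedGraph.#E G ∸ OrientedGraph.#V G in
    (Γ : AbelianGroup c r) (k : ℕ) →
    HasCardinality (AbelianGroup.setoid Γ) k → k ≥ℕ 6 →
    (f : OrientedGraph.Edge G → AbelianGroup.Carrier Γ) →
    ∃[ N ] (HasCardinality (Flows.flowsAvoiding G Γ f) N
    × (2 ∤ k → + N / 1 ≥ ½ * ((+ k ℤ.- + 6) / 2) ^ ℓ)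
    × (2 ∣ k → + N / 1 ≥ ½ * ((+ k ℤ.- + 4) / 2) ^ ℓ))
-- `k` has one parity: the count comes from the matching case, and the other implication is vacuous.
theorem1p9 G conn Γ k finite 6≤k f with 2 ∣? k
... | yes 2∣k with N , card , bound ← even-count Γ finite G conn f 2∣k 6≤k =
  N , card , (λ 2∤k → contradiction 2∣k 2∤k) ,
  λ _ → rational-bound (OrientedGraph.#E G ∸ OrientedGraph.#V G) N (≤-trans (ℕ.m≤m+n 4 2) 6≤k) bound
... | no 2∤k with N , card , bound ← odd-count Γ finite G conn f 2∤k 6≤k =
  N , card , (λ _ → rational-bound (OrientedGraph.#E G ∸ OrientedGraph.#V G) N 6≤k bound) ,
  λ 2∣k → contradiction 2∣k 2∤k
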